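{- Let $k=\ell r$ with integers $\ell\ge2$, $r\ge2$, and fix $m$ with $2\le m\le\ell$. Let $f=\sum_{j=0}^{r-1}2^{j\ell}c_j:\mathbb{F}_2^n\to\mathbb{Z}_{2^k}$ be a function with $2^\ell$-adic components $c_j:\mathbb{F}_2^n\to\mathbb{Z}_{2^\ell}$. For $F:(\mathbb{Z}_{2^\ell})^{r-1}\to\mathbb{Z}_{2^m}$ let $f_F:\mathbb{F}_2^n\to\mathbb{Z}_{2^\ell}$, $f_F(x)=c_{r-1}(x)+2^{\ell-m}F(c_0(x),\ldots,c_{r-2}(x))$. Suppose $c_{r-1}$ is landscape over $\mathbb{Z}_{2^\ell}$ and that, for every $F=a\cdot\mathbf 1_{\{\alpha^{(0)}\}}$ with $\alpha^{(0)}\in(\mathbb{Z}_{2^\ell})^{r-1}$ and $a\in\{1,2^{m-1}\}$, the function $f_F$ is landscape over $\mathbb{Z}_{2^\ell}$ with $|W_{f_F}(u)|=|W_{c_{r-1}}(u)|$ for all $u\in\mathbb{F}_2^n$. Then $f$ is landscape over $\mathbb{Z}_{2^k}$ with the same levels (as $c_{r-1}$), and $|W_f(u)|=|W_{c_{r-1}}(u)|$ for all $u\in\mathbb{F}_2^n$.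
   Context: Throughout, $n\ge2$ is an even integer, $\zeta_N=e^{2\pi i/N}$, $\langle u,x\rangle=\sum u_ix_i$. For $h:\mathbb{F}_2^n\to\mathbb{Z}_{2^j}$, $W_h(u)=\sum_{x}\zeta_{2^j}^{h(x)}(-1)^{\langle u,x\rangle}$ (the Walsh–Hadamard transform over $\mathbb{Z}_{2^j}$). The $2^\ell$-adic decomposition of $f:\mathbb{F}_2^n\to\mathbb{Z}_{2^k}$, $k=\ell r$, is the unique expression $f=\sum_{j=0}^{r-1}2^{j\ell}c_j$ with digit values $c_j(x)\in\{0,\ldots,2^\ell-1\}$. $\mathbf 1_{\{\alpha^{(0)}\}}$ is the indicator of the point $\alpha^{(0)}$; $2^{\ell-m}F(\cdot)$ is computed in $\mathbb{Z}_{2^\ell}$. $h$ is landscape over $\mathbb{Z}_{2^j}$ if there exist $t\ge1$, integers $m_i\ge0$, odd positive $v_i$ with $\{|W_h(u)|:u\in\mathrm{supp}(W_h)\}=\{2^{m_1/2}v_1,\ldots,2^{m_t/2}v_t\}$; the pairs $(m_i,v_i)$ are its levels. -}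

module Defs where

open import Data.Nat using (ℕ; zero; suc; _+_; _*_; _∸_; _^_; _≤_; _<_; _/_; _%_; _≟_)
open import Data.Nat.Properties using (m^n≢0)
open import Data.Nat.DivMod using (_mod_)
open import Data.Integer as ℤ using (ℤ; +_)
open import Data.Fin as Fin using (Fin; toℕ)
import Data.Fin.Properties as FinP
open import Data.Bool using (Bool; true; false; _∧_; _xor_; if_then_else_)
open import Data.List using (List; []; _∷_; concatMap; foldr; map)
open import Data.Product using (Σ; _×_; ∃; ∃-syntax; _,_)
open import Relation.Nullary using (¬_; does)
open import Relation.Binary.PropositionalEquality using (_≡_)
open import Function.Bundles using (_⇔_)

V : ℕ → Set
V n = Fin n → Bool

allV : (n : ℕ) → List (V n)
allV zero = (λ ()) ∷ []
allV (suc n) = concatMap (λ v → cons false v ∷ cons true v ∷ []) (allV n)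
  where
  cons : Bool → V n → V (suc n)
  cons b v Fin.zero = b
  cons b v (Fin.suc i) = v i

inner : {n : ℕ} → V n → V n → Bool
inner {zero} u x = false
inner {suc n} u x = (u Fin.zero ∧ x Fin.zero) xor inner {n} (λ i → u (Fin.suc i)) (λ i → x (Fin.suc i))

sumℤ : {A : Set} → (A → ℤ) → List A → ℤ
sumℤ g xs = foldr (λ a acc → g a ℤ.+ acc) (+ 0) xs

-- ζ_{2^K}^e and friends, K ≥ 1.
-- The ring ℤ[ζ_{2^K}] ≅ ℤ[X]/(X^{2^{K-1}}+1) has ℤ-basis 1, ζ, …, ζ^{2^{K-1}-1};
-- an element is represented by its coefficient function ℕ → ℤ, of which only the
-- indices i < 2^{K-1} are meaningful.
Cyc : Set
Cyc = ℕ → ℤ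

half : ℕ → ℕ
half K = 2 ^ (K ∸ 1)

_≈[_]_ : Cyc → ℕ → Cyc → Set
a ≈[ K ] b = ∀ i → i < half K → a i ≡ b i

modPow2 : ℕ → ℕ → ℕ
modPow2 K a = _%_ a (2 ^ K) {{m^n≢0 2 K}}

-- coefficients of ζ_{2^K}^e   (uses ζ^{2^{K-1}} = -1)
zpow : ℕ → ℕ → Cyc
zpow K e i with does (modPow2 K e ≟ i) | does (modPow2 K e ≟ i + half K)
... | true  | _     = + 1
... | false | true  = ℤ.- (+ 1)
... | false | false = + 0

const : ℤ → Cyc
const c zero = c
const c (suc i) = + 0

sgn : Bool → ℤ
sgn false = + 1
sgn true  = ℤ.- (+ 1)

-- Walsh–Hadamard transform of h : 𝔽₂ⁿ → ℤ_{2^j}, computed in ℤ[ζ_{2^K}] with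
-- ζ_{2^j} = ζ_{2^K}^s, s = 2^{K-j}.  (For the transform over ℤ_{2^j} itself take K = j, s = 1.)
-- W(u) = Σ_x ζ_{2^K}^{s·h(x)} (-1)^{⟨u,x⟩}
Wt : (n K s : ℕ) → (V n → ℕ) → V n → Cyc
Wt n K s h u i = sumℤ (λ x → sgn (inner u x) ℤ.* zpow K (s * h x) i) (allV n)

-- |W(u)|² = W(u)·conj(W(u)) = Σ_{x,y} ζ^{s h(x) - s h(y)} (-1)^{⟨u,x⟩+⟨u,y⟩}
absSq : (n K s : ℕ) → (V n → ℕ) → V n → Cyc
absSq n K s h u i =
  sumℤ (λ x → sumℤ (λ y → sgn (inner u x xor inner u y)
                         ℤ.* zpow K (s * h x + (2 ^ K ∸ modPow2 K (s * h y))) i)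
                   (allV n))
       (allV n)

W : (n j : ℕ) → (V n → Fin (2 ^ j)) → V n → Cyc
W n j h = Wt n j 1 (λ x → toℕ (h x))

InSupp : (n j : ℕ) → (V n → Fin (2 ^ j)) → V n → Set
InSupp n j h u = ¬ (W n j h u ≈[ j ] const (+ 0))

-- |W_h(u)| = 2^{m/2} v   ⟺   |W_h(u)|² = 2^m v²  (both sides nonnegative reals)
AbsIs : (n j : ℕ) → (V n → Fin (2 ^ j)) → V n → ℕ → ℕ → Set
AbsIs n j h u m v = absSq n j 1 (λ x → toℕ (h x)) u ≈[ j ] const (+ (2 ^ m * (v * v)))

Odd : ℕ → Set
Odd v = v % 2 ≡ 1

IsLevel : (n j : ℕ) → (V n → Fin (2 ^ j)) → ℕ → ℕ → Set
IsLevel n j h m v = Odd v × ∃[ u ] (InSupp n j h u × AbsIs n j h u m v)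

Landscape : (n j : ℕ) → (V n → Fin (2 ^ j)) → Set
Landscape n j h =
  (∃[ u ] InSupp n j h u) ×
  (∀ u → InSupp n j h u → ∃[ m ] ∃[ v ] (Odd v × AbsIs n j h u m v))

toZ : (j a : ℕ) → Fin (2 ^ j)
toZ j a = _mod_ a (2 ^ j) {{m^n≢0 2 j}}

digit : {n : ℕ} → (k ℓ : ℕ) → (V n → Fin (2 ^ k)) → ℕ → V n → Fin (2 ^ ℓ)
digit k ℓ f i x = toZ ℓ (_/_ (toℕ (f x)) (2 ^ (i * ℓ)) {{m^n≢0 2 (i * ℓ)}})

-- F = a · 1_{α}  : (ℤ_{2^ℓ})^{r-1} → ℤ_{2^m}, values as naturals < 2^m
indF : {q : ℕ} → (ℓ : ℕ) → ℕ → (Fin q → Fin (2 ^ ℓ)) → (Fin q → Fin (2 ^ ℓ)) → ℕ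
indF ℓ a α β = if does (FinP.all? (λ i → α i FinP.≟ β i)) then a else 0

fF : {n : ℕ} → (k ℓ r m : ℕ) → (V n → Fin (2 ^ k)) →
     ((Fin (r ∸ 1) → Fin (2 ^ ℓ)) → ℕ) → V n → Fin (2 ^ ℓ)
fF k ℓ r m f F x =
  toZ ℓ (toℕ (digit k ℓ f (r ∸ 1) x) + 2 ^ (ℓ ∸ m) * F (λ i → digit k ℓ f (toℕ i) x))

Even : ℕ → Set
Even v = v % 2 ≡ 0

{-# OPTIONS --safe #-}

-- Fix u, put M = 2^{(r-1)ℓ} and let A_b be the part of W = W_{c_{r-1}}(u) coming from the points x with
-- f(x) ≡ b mod M, so that W = Σ A_b and W_f(u) = Σ ζ_{2^k}^b A_b.  Write W = D + A with A = A_b and ω = ζ_{2^m}.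
-- The two hypotheses say |D + ωA| = |D - A| = |D + A|.  For q = A D̄ they give q + q̄ = 0 and ωq + ω̄q̄ = 0,
-- hence ω²q = q, and as some power of ω² is -1 this forces q = 0, that is, A W̄ = |A|².
-- Then |A_b|² |W|² = |A_b|⁴ and |W|² = Σ |A_c|², so Σ_{c ≠ b} |A_b A_c|² = 0.  In ℤ[ζ_{2^ℓ}] the constant
-- coefficient of |a|² is the sum of the squares of the coefficients of a, so every A_b Ā_c with c ≠ b vanishes.
-- Hence the phases ζ_{2^k}^b do not matter: |W_f(u)|² = Σ |A_b|² = |W|².
module Submission where

open import Defs
open import Algebra.Bundles using (CommutativeRing)
import Algebra.Properties.CommutativeSemiring.Exp as CExp
import Algebra.Properties.Ring as RingProperties
import Algebra.Properties.Semiring.Exp as Exp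
import Algebra.Solver.Ring.NaturalCoefficients.Default as SemiringSolver
open import Algebra.Structures using (IsCommutativeRing)
open import Data.Bool using (Bool; true; false; if_then_else_; _xor_; T)
open import Data.Empty using (⊥-elim)
open import Data.Fin using (Fin; toℕ; fromℕ<)
import Data.Fin.Properties as FinP
open import Data.Integer as ℤ using (ℤ; +_)
import Data.Integer.Properties as ℤP
open import Data.List using (List; []; _∷_; upTo)
open import Data.List.Membership.Propositional using (_∈_)
open import Data.List.Membership.Propositional.Properties using (∈-upTo⁺; ∈-upTo⁻)
open import Data.List.Relation.Unary.All as All using (All; []; _∷_)
open import Data.List.Relation.Unary.AllPairs using (_∷_)
open import Data.List.Relation.Unary.Any using (here; there)
open import Data.List.Relation.Unary.Unique.Propositional using (Unique)
open import Data.List.Relation.Unary.Unique.Propositional.Properties using (upTo⁺)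
open import Data.Nat using (ℕ; zero; suc; _+_; _*_; _∸_; _^_; _≤_; _<_; _%_; _/_; _≟_; NonZero; pred; z≤n; s≤s; s≤s⁻¹)
open import Data.Nat.Divisibility using (_∣_; n∣m*n; m∣m*n)
open import Data.Nat.DivMod using (m%n<n; m≡m%n+[m/n]*n; m∣n⇒o%n%m≡o%m; m%[n*o]/o≡m/o%n; %-congʳ; n%1≡0; m<n*o⇒m/o<n; m<n⇒m%n≡m)
import Data.Nat.Properties as ℕP
open import Data.Nat.Properties using (m^n≢0)
open import Data.Product using (_×_; _,_; proj₁; proj₂)
open import Data.Sum using (_⊎_; inj₁; inj₂)
open import Data.Unit using (tt)
open import Function using (_∘_; id)
open import Function.Bundles using (_⇔_; mk⇔; Equivalence)
open import Level using (0ℓ)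
open import Relation.Binary.Definitions using (DecidableEquality)
open import Relation.Binary.PropositionalEquality using (_≡_; _≢_; refl; sym; trans; cong; cong₂; subst; isEquivalence; module ≡-Reasoning)
open import Relation.Nullary using (does; yes; no)
open import Relation.Nullary.Decidable using (dec-false; does-⇔)

open ≡-Reasoning

-- The obstacle is positivity. The definitions offer coefficient functions and no complex numbers,
-- and a real element such as |A_b A_c|² of the cyclotomic ring carries no visible sign. The
-- functional `τ` replaces the order: it is the field trace divided by the degree, that is, the
-- average over all complex embeddings, so it is an integer, nonnegative at a ā, and zero there only
-- for a = 0. The rings are obtained from ℤ, where `ζ` is -1, by adjoining a square root of `ζ`
-- again and again; nested pairs of integers make equality in the ring the same as equality of
-- coefficients. The two values of a have separate tasks. For a = 2^{m-1} the factor ω^a is -1,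
-- which forces q + q̄ = 0. For a = 1 it is ω itself, and m ≥ 2 makes -1 a power of ω², namely the
-- power 2^{m-2}, which excludes a nonzero q.

-- Commutative rings with conjugation and a positive trace form.

-- In ℤ[ζ_{2^K}] the functional τ reads off the coefficient of 1, so that τ (a ā) is the sum of the
-- squares of the coefficients of a.
record StarRing : Set₁ where
  infixl 6 _⊕_
  infixl 7 _⊗_
  infix 8 ⊖_
  field
    Carrier : Set
    _⊕_ _⊗_ : Carrier → Carrier → Carrier
    ⊖_ : Carrier → Carrier
    0# 1# : Carrier
    isCommutativeRing : IsCommutativeRing _≡_ _⊕_ _⊗_ ⊖_ 0# 1#
    conj : Carrier → Carrier
    conj-⊕ : ∀ a b → conj (a ⊕ b) ≡ conj a ⊕ conj b
    conj-⊗ : ∀ a b → conj (a ⊗ b) ≡ conj a ⊗ conj b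
    conj-⊖ : ∀ a → conj (⊖ a) ≡ ⊖ conj a
    conj-0 : conj 0# ≡ 0#
    conj-1 : conj 1# ≡ 1#
    conj-involutive : ∀ a → conj (conj a) ≡ a
    ζ : Carrier
    ζ-unitary : ζ ⊗ conj ζ ≡ 1#
    τ : Carrier → ℤ
    τ-⊕ : ∀ a b → τ (a ⊕ b) ≡ τ a ℤ.+ τ b
    τ-0 : τ 0# ≡ + 0
    τ-nonneg : ∀ a → + 0 ℤ.≤ τ (a ⊗ conj a)
    τ-definite : ∀ a → τ (a ⊗ conj a) ≡ + 0 → a ≡ 0#

  commutativeRing : CommutativeRing 0ℓ 0ℓ
  commutativeRing = record { isCommutativeRing = isCommutativeRing }

  open CommutativeRing commutativeRing public
    using (ring; semiring; commutativeSemiring; +-assoc; +-comm; +-identityˡ; +-identityʳ; -‿inverseˡ; -‿inverseʳ;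
           *-assoc; *-comm; *-identityˡ; *-identityʳ; distribˡ; distribʳ; zeroˡ; zeroʳ)
  open RingProperties ring public
    using (-‿distribʳ-*; -1*x≈-x; -‿involutive; +-cancelˡ; +-cancelʳ; -0#≈0#)
  open Exp semiring public using (^-homo-*; ^-assocʳ) renaming (_^_ to _↑_)
  open CExp commutativeSemiring public using (^-distrib-*)
  module Solver = SemiringSolver commutativeSemiring

ℤ-starRing : StarRing
ℤ-starRing = record
  { Carrier = ℤ
  ; _⊕_ = ℤ._+_ ; _⊗_ = ℤ._*_ ; ⊖_ = ℤ.-_ ; 0# = + 0 ; 1# = + 1
  ; isCommutativeRing = ℤP.+-*-isCommutativeRing
  ; conj = id
  ; conj-⊕ = λ _ _ → refl
  ; conj-⊗ = λ _ _ → refl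
  ; conj-⊖ = λ _ → refl
  ; conj-0 = refl
  ; conj-1 = refl
  ; conj-involutive = λ _ → refl
  -- The tower starts at K = 1 with ζ_2 = -1, where conjugation and `τ` are the identity.
  ; ζ = ℤ.- (+ 1)
  ; ζ-unitary = refl
  ; τ = id
  ; τ-⊕ = λ _ _ → refl
  ; τ-0 = refl
  ; τ-nonneg = square-nonneg
  ; τ-definite = square-definite
  }
  where
  square-nonneg : ∀ a → + 0 ℤ.≤ a ℤ.* a
  square-nonneg (+ n) = subst (+ 0 ℤ.≤_) (ℤP.pos-* n n) (ℤ.+≤+ z≤n)
  square-nonneg (ℤ.-[1+ n ]) = ℤ.+≤+ z≤n

  square-definite : ∀ a → a ℤ.* a ≡ + 0 → a ≡ + 0
  square-definite a eq with ℤP.i*j≡0⇒i≡0∨j≡0 a eq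
  ... | inj₁ p = p
  ... | inj₂ p = p

nonneg-sum-zero : ∀ {a b} → + 0 ℤ.≤ a → + 0 ℤ.≤ b → a ℤ.+ b ≡ + 0 → a ≡ + 0 × b ≡ + 0
nonneg-sum-zero {+ zero} {+ zero} _ _ _ = refl , refl

-- Adjoining a square root of ζ.

module Doubling (S : StarRing) where
  open StarRing S
  open Solver using (solve; _:+_; _:*_; _:=_)

  private
    D : Set
    D = Carrier × Carrier

    _⊕′_ _⊗′_ : D → D → D
    (a , b) ⊕′ (c , d) = a ⊕ c , b ⊕ d
    (a , b) ⊗′ (c , d) = a ⊗ c ⊕ ζ ⊗ (b ⊗ d) , a ⊗ d ⊕ b ⊗ c

    ⊖′_ : D → D
    ⊖′ (a , b) = ⊖ a , ⊖ b

    -- The conjugate of √ζ is its inverse, which equals ζ̄ √ζ; hence b√ζ goes to (ζ̄ b̄)√ζ.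
    conj′ : D → D
    conj′ (a , b) = conj a , conj ζ ⊗ conj b

    ζ-cancel : ∀ b d → ζ ⊗ (b ⊗ (conj ζ ⊗ d)) ≡ b ⊗ d
    ζ-cancel b d = begin
      ζ ⊗ (b ⊗ (conj ζ ⊗ d)) ≡⟨ solve 4 (λ z b w d → z :* (b :* (w :* d)) := (z :* w) :* (b :* d)) refl ζ b (conj ζ) d ⟩
      (ζ ⊗ conj ζ) ⊗ (b ⊗ d) ≡⟨ cong (_⊗ (b ⊗ d)) ζ-unitary ⟩
      1# ⊗ (b ⊗ d)           ≡⟨ *-identityˡ _ ⟩
      b ⊗ d                  ∎

    *-comm′ : ∀ x y → x ⊗′ y ≡ y ⊗′ x
    *-comm′ (a , b) (c , d) = cong₂ _,_
      (solve 5 (λ a b c d z → a :* c :+ z :* (b :* d) := c :* a :+ z :* (d :* b)) refl a b c d ζ)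
      (solve 4 (λ a b c d → a :* d :+ b :* c := c :* b :+ d :* a) refl a b c d)

    *-assoc′ : ∀ x y z → (x ⊗′ y) ⊗′ z ≡ x ⊗′ (y ⊗′ z)
    *-assoc′ (a , b) (c , d) (e , f) = cong₂ _,_
      (solve 7 (λ a b c d e f z → (a :* c :+ z :* (b :* d)) :* e :+ z :* ((a :* d :+ b :* c) :* f)
                               := a :* (c :* e :+ z :* (d :* f)) :+ z :* (b :* (c :* f :+ d :* e)))
             refl a b c d e f ζ)
      (solve 7 (λ a b c d e f z → (a :* c :+ z :* (b :* d)) :* f :+ (a :* d :+ b :* c) :* e
                               := a :* (c :* f :+ d :* e) :+ b :* (c :* e :+ z :* (d :* f)))
             refl a b c d e f ζ)

    *-identityˡ′ : ∀ x → (1# , 0#) ⊗′ x ≡ x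
    *-identityˡ′ (a , b) = cong₂ _,_
      (trans (cong₂ _⊕_ (*-identityˡ a) (trans (cong (ζ ⊗_) (zeroˡ b)) (zeroʳ ζ))) (+-identityʳ a))
      (trans (cong₂ _⊕_ (*-identityˡ b) (zeroˡ a)) (+-identityʳ b))

    distribˡ′ : ∀ x y z → x ⊗′ (y ⊕′ z) ≡ (x ⊗′ y) ⊕′ (x ⊗′ z)
    distribˡ′ (a , b) (c , d) (e , f) = cong₂ _,_
      (solve 7 (λ a b c d e f z → a :* (c :+ e) :+ z :* (b :* (d :+ f))
                               := (a :* c :+ z :* (b :* d)) :+ (a :* e :+ z :* (b :* f)))
             refl a b c d e f ζ)
      (solve 6 (λ a b c d e f → a :* (d :+ f) :+ b :* (c :+ e) := (a :* d :+ b :* c) :+ (a :* f :+ b :* e))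
             refl a b c d e f)

    isCommutativeRing′ : IsCommutativeRing _≡_ _⊕′_ _⊗′_ ⊖′_ (0# , 0#) (1# , 0#)
    isCommutativeRing′ = record
      { isRing = record
        { +-isAbelianGroup = record
          { isGroup = record
            { isMonoid = record
              { isSemigroup = record
                { isMagma = record { isEquivalence = isEquivalence ; ∙-cong = cong₂ _⊕′_ }
                ; assoc = λ _ _ _ → cong₂ _,_ (+-assoc _ _ _) (+-assoc _ _ _)
                }
              ; identity = (λ _ → cong₂ _,_ (+-identityˡ _) (+-identityˡ _))
                         , (λ _ → cong₂ _,_ (+-identityʳ _) (+-identityʳ _))
              }
            ; inverse = (λ _ → cong₂ _,_ (-‿inverseˡ _) (-‿inverseˡ _))
                      , (λ _ → cong₂ _,_ (-‿inverseʳ _) (-‿inverseʳ _))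
            ; ⁻¹-cong = cong ⊖′_
            }
          ; comm = λ _ _ → cong₂ _,_ (+-comm _ _) (+-comm _ _)
          }
        ; *-cong = cong₂ _⊗′_
        ; *-assoc = *-assoc′
        ; *-identity = *-identityˡ′ , λ x → trans (*-comm′ x _) (*-identityˡ′ x)
        ; distrib = distribˡ′ , λ x y z → trans (*-comm′ _ x) (trans (distribˡ′ x y z) (cong₂ _⊕′_ (*-comm′ x y) (*-comm′ x z)))
        }
      ; *-comm = *-comm′
      }

    conj-⊗′ : ∀ x y → conj′ (x ⊗′ y) ≡ conj′ x ⊗′ conj′ y
    conj-⊗′ (a , b) (c , d) = cong₂ _,_
      (begin
        conj (a ⊗ c ⊕ ζ ⊗ (b ⊗ d))
          ≡⟨ conj-⊕ _ _ ⟩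
        conj (a ⊗ c) ⊕ conj (ζ ⊗ (b ⊗ d))
          ≡⟨ cong₂ _⊕_ (conj-⊗ a c) (trans (conj-⊗ ζ _) (cong (conj ζ ⊗_) (conj-⊗ b d))) ⟩
        conj a ⊗ conj c ⊕ conj ζ ⊗ (conj b ⊗ conj d)
          ≡⟨ cong (conj a ⊗ conj c ⊕_) (trans (ζ-cancel _ _) (*-assoc _ _ _)) ⟨
        conj a ⊗ conj c ⊕ ζ ⊗ ((conj ζ ⊗ conj b) ⊗ (conj ζ ⊗ conj d)) ∎)
      (begin
        conj ζ ⊗ conj (a ⊗ d ⊕ b ⊗ c)
          ≡⟨ cong (conj ζ ⊗_) (trans (conj-⊕ _ _) (cong₂ _⊕_ (conj-⊗ a d) (conj-⊗ b c))) ⟩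
        conj ζ ⊗ (conj a ⊗ conj d ⊕ conj b ⊗ conj c)
          ≡⟨ solve 5 (λ z a b c d → z :* (a :* d :+ b :* c) := a :* (z :* d) :+ (z :* b) :* c)
                   refl (conj ζ) (conj a) (conj b) (conj c) (conj d) ⟩
        conj a ⊗ (conj ζ ⊗ conj d) ⊕ (conj ζ ⊗ conj b) ⊗ conj c ∎)

    -- The trace form of the doubled ring is the orthogonal sum of two copies of the old one,
    -- because the factor ζ from √ζ · √ζ meets the ζ̄ from conjugation. Nonnegativity and
    -- definiteness are inherited through this.
    norm-τ : ∀ a b → τ (a ⊗ conj a ⊕ ζ ⊗ (b ⊗ (conj ζ ⊗ conj b))) ≡ τ (a ⊗ conj a) ℤ.+ τ (b ⊗ conj b)
    norm-τ a b = trans (τ-⊕ _ _) (cong (λ t → τ (a ⊗ conj a) ℤ.+ τ t) (ζ-cancel b (conj b)))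

  -- S[√ζ], the pair (a , b) standing for a + b√ζ.
  double : StarRing
  double = record
    { Carrier = D
    ; _⊕_ = _⊕′_ ; _⊗_ = _⊗′_ ; ⊖_ = ⊖′_ ; 0# = 0# , 0# ; 1# = 1# , 0#
    ; isCommutativeRing = isCommutativeRing′
    ; conj = conj′
    ; conj-⊕ = λ (a , b) (c , d) → cong₂ _,_ (conj-⊕ a c) (trans (cong (conj ζ ⊗_) (conj-⊕ b d)) (distribˡ _ _ _))
    ; conj-⊗ = conj-⊗′
    ; conj-⊖ = λ (a , b) → cong₂ _,_ (conj-⊖ a) (trans (cong (conj ζ ⊗_) (conj-⊖ b)) (sym (-‿distribʳ-* _ _)))
    ; conj-0 = cong₂ _,_ conj-0 (trans (cong (conj ζ ⊗_) conj-0) (zeroʳ _))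
    ; conj-1 = cong₂ _,_ conj-1 (trans (cong (conj ζ ⊗_) conj-0) (zeroʳ _))
    ; conj-involutive = λ (a , b) → cong₂ _,_ (conj-involutive a) (begin
        conj ζ ⊗ conj (conj ζ ⊗ conj b)        ≡⟨ cong (conj ζ ⊗_) (conj-⊗ _ _) ⟩
        conj ζ ⊗ (conj (conj ζ) ⊗ conj (conj b)) ≡⟨ cong₂ (λ s t → conj ζ ⊗ (s ⊗ t)) (conj-involutive ζ) (conj-involutive b) ⟩
        conj ζ ⊗ (ζ ⊗ b)                       ≡⟨ solve 3 (λ w z b → w :* (z :* b) := z :* (b :* w)) refl (conj ζ) ζ b ⟩
        ζ ⊗ (b ⊗ conj ζ)                       ≡⟨ cong (λ t → ζ ⊗ (b ⊗ t)) (*-identityʳ _) ⟨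
        ζ ⊗ (b ⊗ (conj ζ ⊗ 1#))                ≡⟨ ζ-cancel b 1# ⟩
        b ⊗ 1#                                 ≡⟨ *-identityʳ b ⟩
        b                                      ∎)
    ; ζ = 0# , 1#
    ; ζ-unitary = cong₂ _,_
        (trans (cong₂ _⊕_ (zeroˡ _) (trans (ζ-cancel _ _) (trans (*-identityˡ _) conj-1))) (+-identityˡ _))
        (trans (cong₂ _⊕_ (zeroˡ _) (trans (*-identityˡ _) conj-0)) (+-identityˡ _))
    ; τ = τ ∘ proj₁
    ; τ-⊕ = λ x y → τ-⊕ (proj₁ x) (proj₁ y)
    ; τ-0 = τ-0
    ; τ-nonneg = λ (a , b) → subst (+ 0 ℤ.≤_) (sym (norm-τ a b)) (ℤP.+-mono-≤ (τ-nonneg a) (τ-nonneg b))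
    ; τ-definite = λ (a , b) eq →
        let p , q = nonneg-sum-zero (τ-nonneg a) (τ-nonneg b) (trans (sym (norm-τ a b)) eq)
        in cong₂ _,_ (τ-definite a p) (τ-definite b q)
    }

open Doubling using (double)

-- tower j is ℤ[ζ_{2^{j+1}}].
tower : ℕ → StarRing
tower zero = ℤ-starRing
tower (suc j) = double (tower j)

-- Finite sums, signs and torsion in a star ring.

module StarRingProperties (S : StarRing) where
  open StarRing S
  open Solver using (solve; _:+_; _:*_; _:=_)

  norm-definite : ∀ {a} → a ⊗ conj a ≡ 0# → a ≡ 0#
  norm-definite {a} eq = τ-definite a (trans (cong τ eq) τ-0)

  -- Multiplying by ā and applying `τ` moves the claim to ℤ, where a nonnegative integer added to
  -- itself vanishes only at 0.
  2-torsion-free : ∀ {a} → a ⊕ a ≡ 0# → a ≡ 0#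
  2-torsion-free {a} eq = τ-definite a (proj₁ (nonneg-sum-zero (τ-nonneg a) (τ-nonneg a) (begin
    τ (a ⊗ conj a) ℤ.+ τ (a ⊗ conj a) ≡⟨ τ-⊕ _ _ ⟨
    τ (a ⊗ conj a ⊕ a ⊗ conj a)       ≡⟨ cong τ (distribʳ _ _ _) ⟨
    τ ((a ⊕ a) ⊗ conj a)              ≡⟨ cong (λ t → τ (t ⊗ conj a)) eq ⟩
    τ (0# ⊗ conj a)                   ≡⟨ cong τ (zeroˡ _) ⟩
    τ 0#                              ≡⟨ τ-0 ⟩
    + 0                               ∎)))

  conj-↑ : ∀ a e → conj (a ↑ e) ≡ conj a ↑ e
  conj-↑ a zero = conj-1
  conj-↑ a (suc e) = trans (conj-⊗ _ _) (cong (conj a ⊗_) (conj-↑ a e))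

  1-↑ : ∀ e → 1# ↑ e ≡ 1#
  1-↑ zero = refl
  1-↑ (suc e) = trans (*-identityˡ _) (1-↑ e)

  ↑-unitary : ∀ {a} e → a ⊗ conj a ≡ 1# → (a ↑ e) ⊗ conj (a ↑ e) ≡ 1#
  ↑-unitary {a} e eq = begin
    (a ↑ e) ⊗ conj (a ↑ e) ≡⟨ cong ((a ↑ e) ⊗_) (conj-↑ a e) ⟩
    (a ↑ e) ⊗ (conj a ↑ e) ≡⟨ ^-distrib-* a (conj a) e ⟨
    (a ⊗ conj a) ↑ e       ≡⟨ cong (_↑ e) eq ⟩
    1# ↑ e                 ≡⟨ 1-↑ e ⟩
    1#                     ∎

  sign : Bool → Carrier
  sign false = 1#
  sign true = ⊖ 1#

  conj-sign : ∀ b → conj (sign b) ≡ sign b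
  conj-sign false = conj-1
  conj-sign true = trans (conj-⊖ 1#) (cong ⊖_ conj-1)

  sign-xor : ∀ b c → sign (b xor c) ≡ sign b ⊗ sign c
  sign-xor false c = sym (*-identityˡ _)
  sign-xor true false = sym (*-identityʳ _)
  sign-xor true true = sym (trans (-1*x≈-x _) (-‿involutive _))

  ∑ : {I : Set} → List I → (I → Carrier) → Carrier
  ∑ [] f = 0#
  ∑ (x ∷ xs) f = f x ⊕ ∑ xs f

  module _ {I : Set} where

    ∑-cong-∈ : ∀ (xs : List I) {f g} → (∀ x → x ∈ xs → f x ≡ g x) → ∑ xs f ≡ ∑ xs g
    ∑-cong-∈ [] eq = refl
    ∑-cong-∈ (x ∷ xs) eq = cong₂ _⊕_ (eq x (here refl)) (∑-cong-∈ xs (λ y y∈ → eq y (there y∈)))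

    ∑-cong : ∀ (xs : List I) {f g} → (∀ x → f x ≡ g x) → ∑ xs f ≡ ∑ xs g
    ∑-cong xs eq = ∑-cong-∈ xs (λ x _ → eq x)

    ∑-0 : ∀ (xs : List I) → ∑ xs (λ _ → 0#) ≡ 0#
    ∑-0 [] = refl
    ∑-0 (x ∷ xs) = trans (+-identityˡ _) (∑-0 xs)

    ∑-⊕ : ∀ (xs : List I) f g → ∑ xs (λ x → f x ⊕ g x) ≡ ∑ xs f ⊕ ∑ xs g
    ∑-⊕ [] f g = sym (+-identityˡ 0#)
    ∑-⊕ (x ∷ xs) f g = trans (cong (f x ⊕ g x ⊕_) (∑-⊕ xs f g))
      (solve 4 (λ a b c d → (a :+ b) :+ (c :+ d) := (a :+ c) :+ (b :+ d)) refl (f x) (g x) (∑ xs f) (∑ xs g))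

    ∑-⊗ˡ : ∀ (xs : List I) c f → c ⊗ ∑ xs f ≡ ∑ xs (λ x → c ⊗ f x)
    ∑-⊗ˡ [] c f = zeroʳ c
    ∑-⊗ˡ (x ∷ xs) c f = trans (distribˡ _ _ _) (cong (c ⊗ f x ⊕_) (∑-⊗ˡ xs c f))

    ∑-⊗ʳ : ∀ (xs : List I) f c → ∑ xs f ⊗ c ≡ ∑ xs (λ x → f x ⊗ c)
    ∑-⊗ʳ xs f c = trans (*-comm _ _) (trans (∑-⊗ˡ xs c f) (∑-cong xs (λ x → *-comm _ _)))

    conj-∑ : ∀ (xs : List I) f → conj (∑ xs f) ≡ ∑ xs (conj ∘ f)
    conj-∑ [] f = conj-0
    conj-∑ (x ∷ xs) f = trans (conj-⊕ _ _) (cong (conj (f x) ⊕_) (conj-∑ xs f))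

    ∑-⊗-conj-∑ : ∀ (xs : List I) f → ∑ xs f ⊗ conj (∑ xs f) ≡ ∑ xs (λ x → ∑ xs (λ y → f x ⊗ conj (f y)))
    ∑-⊗-conj-∑ xs f = trans (cong (∑ xs f ⊗_) (conj-∑ xs f))
      (trans (∑-⊗ʳ xs f _) (∑-cong xs (λ x → ∑-⊗ˡ xs (f x) _)))

    τ-∑-nonneg : ∀ (xs : List I) f → (∀ x → + 0 ℤ.≤ τ (f x)) → + 0 ℤ.≤ τ (∑ xs f)
    τ-∑-nonneg [] f f≥0 = ℤP.≤-reflexive (sym τ-0)
    τ-∑-nonneg (x ∷ xs) f f≥0 = subst (+ 0 ℤ.≤_) (sym (τ-⊕ _ _)) (ℤP.+-mono-≤ (f≥0 x) (τ-∑-nonneg xs f f≥0))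

    τ-∑-zero : ∀ (xs : List I) f → (∀ x → + 0 ℤ.≤ τ (f x)) → τ (∑ xs f) ≡ + 0 → ∀ x → x ∈ xs → τ (f x) ≡ + 0
    τ-∑-zero (x ∷ xs) f f≥0 eq y y∈
      with y∈ | nonneg-sum-zero (f≥0 x) (τ-∑-nonneg xs f f≥0) (trans (sym (τ-⊕ _ _)) eq)
    ... | here refl | p , _ = p
    ... | there y∈′ | _ , q = τ-∑-zero xs f f≥0 q y y∈′

    module _ (_≟_ : DecidableEquality I) where

      ∑-single-∉ : ∀ (xs : List I) b (f : I → Carrier) → All (b ≢_) xs → ∑ xs (λ c → if does (b ≟ c) then f c else 0#) ≡ 0#
      ∑-single-∉ [] b f [] = refl
      ∑-single-∉ (x ∷ xs) b f (b≢x ∷ b∉) with b ≟ x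
      ... | yes b≡x = ⊥-elim (b≢x b≡x)
      ... | no _ = trans (+-identityˡ _) (∑-single-∉ xs b f b∉)

      ∑-single : ∀ {xs : List I} {b} (f : I → Carrier) → Unique xs → b ∈ xs → ∑ xs (λ c → if does (b ≟ c) then f c else 0#) ≡ f b
      ∑-single {x ∷ xs} {b} f (x∉ ∷ _) (here refl) with b ≟ x
      ... | yes _ = trans (cong (f b ⊕_) (∑-single-∉ xs b f x∉)) (+-identityʳ _)
      ... | no b≢b = ⊥-elim (b≢b refl)
      ∑-single {x ∷ xs} {b} f (x∉ ∷ u) (there b∈) with b ≟ x
      ... | yes refl = ⊥-elim (All.lookup x∉ b∈ refl)
      ... | no _ = trans (+-identityˡ _) (∑-single f u b∈)

  ∑-swap : ∀ {I J : Set} (xs : List I) (ys : List J) (f : I → J → Carrier) →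
    ∑ xs (λ x → ∑ ys (f x)) ≡ ∑ ys (λ y → ∑ xs (λ x → f x y))
  ∑-swap [] ys f = sym (∑-0 ys)
  ∑-swap (x ∷ xs) ys f = trans (cong (∑ ys (f x) ⊕_) (∑-swap xs ys f)) (sym (∑-⊕ ys _ _))

  split-if : ∀ b x → x ≡ (if b then 0# else x) ⊕ (if b then x else 0#)
  split-if true x = sym (+-identityˡ x)
  split-if false x = sym (+-identityʳ x)

  -- Rigidity of one summand under changes of phase.

  -- ω q = ω̄ q gives ω² q = q, hence q = ω^{2e} q = - q.
  opposite-phases : ∀ {ω q} e → ω ⊗ conj ω ≡ 1# → ω ↑ (2 * e) ≡ ⊖ 1# → ω ⊗ q ≡ conj ω ⊗ q → q ≡ 0#
  opposite-phases {ω} {q} e unit minus eq = 2-torsion-free (begin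
    q ⊕ q              ≡⟨ cong (_⊕ q) (fixed e) ⟨
    (ω ↑ 2) ↑ e ⊗ q ⊕ q ≡⟨ cong (λ t → t ⊗ q ⊕ q) (trans (^-assocʳ ω 2 e) minus) ⟩
    (⊖ 1#) ⊗ q ⊕ q     ≡⟨ cong (_⊕ q) (-1*x≈-x q) ⟩
    ⊖ q ⊕ q            ≡⟨ -‿inverseˡ q ⟩
    0#                 ∎)
    where
    ω²q≡q : ω ↑ 2 ⊗ q ≡ q
    ω²q≡q = begin
      (ω ⊗ (ω ⊗ 1#)) ⊗ q ≡⟨ cong (λ t → (ω ⊗ t) ⊗ q) (*-identityʳ ω) ⟩
      (ω ⊗ ω) ⊗ q        ≡⟨ *-assoc _ _ _ ⟩
      ω ⊗ (ω ⊗ q)        ≡⟨ cong (ω ⊗_) eq ⟩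
      ω ⊗ (conj ω ⊗ q)   ≡⟨ *-assoc _ _ _ ⟨
      (ω ⊗ conj ω) ⊗ q   ≡⟨ cong (_⊗ q) unit ⟩
      1# ⊗ q             ≡⟨ *-identityˡ q ⟩
      q                  ∎

    fixed : ∀ e → (ω ↑ 2) ↑ e ⊗ q ≡ q
    fixed zero = *-identityˡ q
    fixed (suc e) = trans (*-assoc _ _ _) (trans (cong (ω ↑ 2 ⊗_) (fixed e)) ω²q≡q)

  -- A phase on A leaves |D|² + |A|² alone and changes only the cross terms. Expanding at the phases
  -- ω and 1 and cancelling the common part compares these cross terms.
  norm-phase : ∀ {ω} A D → ω ⊗ conj ω ≡ 1# →
    (D ⊕ ω ⊗ A) ⊗ conj (D ⊕ ω ⊗ A) ≡ (D ⊕ A) ⊗ conj (D ⊕ A) →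
    ω ⊗ (A ⊗ conj D) ⊕ conj ω ⊗ conj (A ⊗ conj D) ≡ A ⊗ conj D ⊕ conj (A ⊗ conj D)
  norm-phase {ω} A D unit eq = +-cancelˡ (D ⊗ conj D ⊕ A ⊗ conj A) _ _ (begin
    D ⊗ conj D ⊕ A ⊗ conj A ⊕ (ω ⊗ q ⊕ conj ω ⊗ conj q)
      ≡⟨ expand ω unit ⟨
    (D ⊕ ω ⊗ A) ⊗ conj (D ⊕ ω ⊗ A)
      ≡⟨ eq ⟩
    (D ⊕ A) ⊗ conj (D ⊕ A)
      ≡⟨ cong (λ t → (D ⊕ t) ⊗ conj (D ⊕ t)) (*-identityˡ A) ⟨
    (D ⊕ 1# ⊗ A) ⊗ conj (D ⊕ 1# ⊗ A)
      ≡⟨ expand 1# (trans (*-identityˡ _) conj-1) ⟩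
    D ⊗ conj D ⊕ A ⊗ conj A ⊕ (1# ⊗ q ⊕ conj 1# ⊗ conj q)
      ≡⟨ cong (D ⊗ conj D ⊕ A ⊗ conj A ⊕_)
              (cong₂ _⊕_ (*-identityˡ q) (trans (cong (_⊗ conj q) conj-1) (*-identityˡ _))) ⟩
    D ⊗ conj D ⊕ A ⊗ conj A ⊕ (q ⊕ conj q) ∎)
    where
    q : Carrier
    q = A ⊗ conj D

    expand : ∀ ω → ω ⊗ conj ω ≡ 1# →
      (D ⊕ ω ⊗ A) ⊗ conj (D ⊕ ω ⊗ A) ≡ D ⊗ conj D ⊕ A ⊗ conj A ⊕ (ω ⊗ q ⊕ conj ω ⊗ conj q)
    expand ω unit = begin
      (D ⊕ ω ⊗ A) ⊗ conj (D ⊕ ω ⊗ A)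
        ≡⟨ cong ((D ⊕ ω ⊗ A) ⊗_) (trans (conj-⊕ _ _) (cong (conj D ⊕_) (conj-⊗ _ _))) ⟩
      (D ⊕ ω ⊗ A) ⊗ (conj D ⊕ conj ω ⊗ conj A)
        ≡⟨ solve 6 (λ D D̄ ω ω̄ A Ā → (D :+ ω :* A) :* (D̄ :+ ω̄ :* Ā)
                      := D :* D̄ :+ (ω :* ω̄) :* (A :* Ā) :+ (ω :* (A :* D̄) :+ ω̄ :* (Ā :* D)))
                 refl D (conj D) ω (conj ω) A (conj A) ⟩
      D ⊗ conj D ⊕ (ω ⊗ conj ω) ⊗ (A ⊗ conj A) ⊕ (ω ⊗ q ⊕ conj ω ⊗ (conj A ⊗ D))
        ≡⟨ cong₂ (λ s t → D ⊗ conj D ⊕ s ⊕ (ω ⊗ q ⊕ conj ω ⊗ t))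
                 (trans (cong (_⊗ (A ⊗ conj A)) unit) (*-identityˡ _))
                 (sym (trans (conj-⊗ A (conj D)) (cong (conj A ⊗_) (conj-involutive D)))) ⟩
      D ⊗ conj D ⊕ A ⊗ conj A ⊕ (ω ⊗ q ⊕ conj ω ⊗ conj q) ∎

  -- The exponent has the form `2 * e` because it is ω² that fixes q, so -1 has to be a power of ω².
  -- The phase -1 alone would only give q̄ = -q.
  rigid-component : ∀ {ω} e A D → ω ⊗ conj ω ≡ 1# → ω ↑ (2 * e) ≡ ⊖ 1# →
    (D ⊕ ω ⊗ A) ⊗ conj (D ⊕ ω ⊗ A) ≡ (D ⊕ A) ⊗ conj (D ⊕ A) →
    (D ⊕ ⊖ 1# ⊗ A) ⊗ conj (D ⊕ ⊖ 1# ⊗ A) ≡ (D ⊕ A) ⊗ conj (D ⊕ A) →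
    A ⊗ conj D ≡ 0#
  rigid-component {ω} e A D unit minus eq₁ eq₂ = opposite-phases e unit minus
    (+-cancelʳ (conj ω ⊗ conj q) _ _ (begin
      ω ⊗ q ⊕ conj ω ⊗ conj q      ≡⟨ norm-phase A D unit eq₁ ⟩
      q ⊕ conj q                   ≡⟨ q+q̄≡0 ⟩
      0#                           ≡⟨ zeroʳ _ ⟨
      -- Writing 0 as ω̄ (q + q̄) puts ω̄ q̄ on both sides; cancelling it removes q̄ and leaves ω q
      -- = ω̄ q.
      conj ω ⊗ 0#                  ≡⟨ cong (conj ω ⊗_) q+q̄≡0 ⟨
      conj ω ⊗ (q ⊕ conj q)        ≡⟨ distribˡ _ _ _ ⟩
      conj ω ⊗ q ⊕ conj ω ⊗ conj q ∎))
    where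
    q : Carrier
    q = A ⊗ conj D

    -1-unitary : ⊖ 1# ⊗ conj (⊖ 1#) ≡ 1#
    -1-unitary = trans (cong (⊖ 1# ⊗_) (conj-sign true)) (sym (sign-xor true true))

    q+q̄≡0 : q ⊕ conj q ≡ 0#
    q+q̄≡0 = 2-torsion-free (begin
      q ⊕ conj q ⊕ (q ⊕ conj q)
        ≡⟨ cong (q ⊕ conj q ⊕_) (norm-phase A D -1-unitary eq₂) ⟨
      q ⊕ conj q ⊕ (⊖ 1# ⊗ q ⊕ conj (⊖ 1#) ⊗ conj q)
        ≡⟨ cong (λ t → q ⊕ conj q ⊕ (⊖ 1# ⊗ q ⊕ t ⊗ conj q)) (conj-sign true) ⟩
      q ⊕ conj q ⊕ (⊖ 1# ⊗ q ⊕ ⊖ 1# ⊗ conj q)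
        ≡⟨ cong (q ⊕ conj q ⊕_) (trans (sym (distribˡ _ _ _)) (-1*x≈-x _)) ⟩
      q ⊕ conj q ⊕ ⊖ (q ⊕ conj q)
        ≡⟨ -‿inverseʳ _ ⟩
      0# ∎)

  -- From orthogonality to the rest to pairwise orthogonality.

  module _ {I : Set} (_≟_ : DecidableEquality I) {xs : List I} (unique : Unique xs) (A : I → Carrier) where

    private
      P : Carrier
      P = ∑ xs A

      p : I → Carrier
      p b = A b ⊗ conj (A b)

    module _ (projects : ∀ b → b ∈ xs → A b ⊗ conj P ≡ p b) where

      -- Pythagoras, obtained by summing `projects` over b: it suffices that each part is orthogonal
      -- to the sum of all the others, so pairwise orthogonality can be deduced afterwards.
      norm-∑ : P ⊗ conj P ≡ ∑ xs p
      norm-∑ = trans (∑-⊗ʳ xs A _) (∑-cong-∈ xs projects)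

      -- The nonnegative elements |A b A c|² with c ≠ b sum to zero.
      orthogonal : ∀ {b c} → b ∈ xs → c ∈ xs → b ≢ c → A b ⊗ conj (A c) ≡ 0#
      -- A_b Ā_c and A_b A_c have the same norm, and it is the norm of the second that appears as
      -- the product `p b ⊗ p c` in the sum.
      orthogonal {b} {c} b∈ c∈ b≢c = norm-definite (begin
        (A b ⊗ conj (A c)) ⊗ conj (A b ⊗ conj (A c))
          ≡⟨ cong ((A b ⊗ conj (A c)) ⊗_) (trans (conj-⊗ _ _) (cong (conj (A b) ⊗_) (conj-involutive _))) ⟩
        (A b ⊗ conj (A c)) ⊗ (conj (A b) ⊗ A c)
          ≡⟨ solve 4 (λ a a̅ c c̅ → (a :* c̅) :* (a̅ :* c) := (a :* c) :* (a̅ :* c̅))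
                   refl (A b) (conj (A b)) (A c) (conj (A c)) ⟩
        (A b ⊗ A c) ⊗ (conj (A b) ⊗ conj (A c))
          ≡⟨ cong ((A b ⊗ A c) ⊗_) (conj-⊗ _ _) ⟨
        (A b ⊗ A c) ⊗ conj (A b ⊗ A c)
          ≡⟨ cong (λ t → t ⊗ conj t) AbAc≡0 ⟩
        0# ⊗ conj 0#
          ≡⟨ zeroˡ _ ⟩
        0# ∎)
        where
        -- The term at d = b is replaced by zero instead of being removed, so that all sums run over
        -- the same list.
        off : I → Carrier
        off d = if does (b ≟ d) then 0# else p b ⊗ p d

        p-product : ∀ d → p b ⊗ p d ≡ (A b ⊗ A d) ⊗ conj (A b ⊗ A d)
        p-product d = trans
          (solve 4 (λ a a̅ c c̅ → (a :* a̅) :* (c :* c̅) := (a :* c) :* (a̅ :* c̅))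
                 refl (A b) (conj (A b)) (A d) (conj (A d)))
          (cong ((A b ⊗ A d) ⊗_) (sym (conj-⊗ _ _)))

        off-nonneg : ∀ d → + 0 ℤ.≤ τ (off d)
        off-nonneg d with does (b ≟ d)
        ... | true = ℤP.≤-reflexive (sym τ-0)
        ... | false = subst (λ t → + 0 ℤ.≤ τ t) (sym (p-product d)) (τ-nonneg _)

        conj-p : conj (p b) ≡ p b
        conj-p = trans (conj-⊗ _ _) (trans (cong (conj (A b) ⊗_) (conj-involutive _)) (*-comm _ _))

        -- Both sides are the norm of `A b ⊗ conj P`, before and after `projects` is applied.
        p-idempotent : p b ⊗ (P ⊗ conj P) ≡ p b ⊗ p b
        p-idempotent = begin
          p b ⊗ (P ⊗ conj P)
            ≡⟨ solve 4 (λ a a̅ w w̄ → (a :* a̅) :* (w :* w̄) := (a :* w̄) :* (a̅ :* w))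
                     refl (A b) (conj (A b)) P (conj P) ⟩
          (A b ⊗ conj P) ⊗ (conj (A b) ⊗ P)
            ≡⟨ cong (λ t → (A b ⊗ conj P) ⊗ (conj (A b) ⊗ t)) (conj-involutive P) ⟨
          (A b ⊗ conj P) ⊗ (conj (A b) ⊗ conj (conj P))
            ≡⟨ cong ((A b ⊗ conj P) ⊗_) (conj-⊗ _ _) ⟨
          (A b ⊗ conj P) ⊗ conj (A b ⊗ conj P)
            ≡⟨ cong (λ t → t ⊗ conj t) (projects b b∈) ⟩
          p b ⊗ conj (p b)
            ≡⟨ cong (p b ⊗_) conj-p ⟩
          p b ⊗ p b ∎

        ∑-off : ∑ xs off ≡ 0#
        ∑-off = +-cancelʳ (p b ⊗ p b) _ _ (begin
          ∑ xs off ⊕ p b ⊗ p b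
            -- Restoring the diagonal term completes the sum to `p b` times |P|², which is again
            -- `p b ⊗ p b`.
            ≡⟨ cong (∑ xs off ⊕_) (∑-single _≟_ (λ d → p b ⊗ p d) unique b∈) ⟨
          ∑ xs off ⊕ ∑ xs (λ d → if does (b ≟ d) then p b ⊗ p d else 0#)
            ≡⟨ ∑-⊕ xs _ _ ⟨
          ∑ xs (λ d → off d ⊕ (if does (b ≟ d) then p b ⊗ p d else 0#))
            ≡⟨ ∑-cong xs (λ d → split-if (does (b ≟ d)) (p b ⊗ p d)) ⟨
          ∑ xs (λ d → p b ⊗ p d)
            ≡⟨ ∑-⊗ˡ xs _ _ ⟨
          p b ⊗ ∑ xs p
            ≡⟨ cong (p b ⊗_) norm-∑ ⟨
          p b ⊗ (P ⊗ conj P)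
            ≡⟨ p-idempotent ⟩
          p b ⊗ p b
            ≡⟨ +-identityˡ _ ⟨
          0# ⊕ p b ⊗ p b ∎)

        off-c : off c ≡ p b ⊗ p c
        off-c with b ≟ c
        ... | yes b≡c = ⊥-elim (b≢c b≡c)
        ... | no _ = refl

        AbAc≡0 : A b ⊗ A c ≡ 0#
        AbAc≡0 = τ-definite _ (begin
          τ ((A b ⊗ A c) ⊗ conj (A b ⊗ A c)) ≡⟨ cong τ (trans off-c (p-product c)) ⟨
          τ (off c)                          ≡⟨ τ-∑-zero xs off off-nonneg (trans (cong τ ∑-off) τ-0) c c∈ ⟩
          + 0                                ∎)

-- Homomorphisms and sums twisted by phases.

-- The image of `ζ` is left open, since the `ζ` of the small ring goes to a power of the `ζ` of the
-- large one. Injectivity serves to pull equations between norms back.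
record StarHom (S T : StarRing) : Set where
  private
    module S = StarRing S
    module T = StarRing T
    module SP = StarRingProperties S
    module TP = StarRingProperties T
  field
    ⟦_⟧ : S.Carrier → T.Carrier
    ⟦⟧-⊕ : ∀ a b → ⟦ a S.⊕ b ⟧ ≡ ⟦ a ⟧ T.⊕ ⟦ b ⟧
    ⟦⟧-⊗ : ∀ a b → ⟦ a S.⊗ b ⟧ ≡ ⟦ a ⟧ T.⊗ ⟦ b ⟧
    ⟦⟧-⊖ : ∀ a → ⟦ S.⊖ a ⟧ ≡ T.⊖ ⟦ a ⟧
    ⟦⟧-0 : ⟦ S.0# ⟧ ≡ T.0#
    ⟦⟧-1 : ⟦ S.1# ⟧ ≡ T.1#
    ⟦⟧-conj : ∀ a → ⟦ S.conj a ⟧ ≡ T.conj ⟦ a ⟧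
    ⟦⟧-injective : ∀ {a b} → ⟦ a ⟧ ≡ ⟦ b ⟧ → a ≡ b

  ⟦⟧-↑ : ∀ a e → ⟦ a S.↑ e ⟧ ≡ ⟦ a ⟧ T.↑ e
  ⟦⟧-↑ a zero = ⟦⟧-1
  ⟦⟧-↑ a (suc e) = trans (⟦⟧-⊗ _ _) (cong (⟦ a ⟧ T.⊗_) (⟦⟧-↑ a e))

  ⟦⟧-sign : ∀ b → ⟦ SP.sign b ⟧ ≡ TP.sign b
  ⟦⟧-sign false = ⟦⟧-1
  ⟦⟧-sign true = trans (⟦⟧-⊖ _) (cong T.⊖_ ⟦⟧-1)

  ⟦⟧-∑ : ∀ {I : Set} (xs : List I) f → ⟦ SP.∑ xs f ⟧ ≡ TP.∑ xs (⟦_⟧ ∘ f)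
  ⟦⟧-∑ [] f = ⟦⟧-0
  ⟦⟧-∑ (x ∷ xs) f = trans (⟦⟧-⊕ _ _) (cong (⟦ f x ⟧ T.⊕_) (⟦⟧-∑ xs f))

  ⟦⟧-norm : ∀ a → ⟦ a S.⊗ S.conj a ⟧ ≡ ⟦ a ⟧ T.⊗ T.conj ⟦ a ⟧
  ⟦⟧-norm a = trans (⟦⟧-⊗ _ _) (cong (⟦ a ⟧ T.⊗_) (⟦⟧-conj a))

id-hom : ∀ {S} → StarHom S S
id-hom = record
  { ⟦_⟧ = id ; ⟦⟧-⊕ = λ _ _ → refl ; ⟦⟧-⊗ = λ _ _ → refl ; ⟦⟧-⊖ = λ _ → refl
  ; ⟦⟧-0 = refl ; ⟦⟧-1 = refl ; ⟦⟧-conj = λ _ → refl ; ⟦⟧-injective = id }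

infixr 9 _∘ₕ_
_∘ₕ_ : ∀ {S T U} → StarHom T U → StarHom S T → StarHom S U
g ∘ₕ f = record
  { ⟦_⟧ = G.⟦_⟧ ∘ F.⟦_⟧
  ; ⟦⟧-⊕ = λ a b → trans (cong G.⟦_⟧ (F.⟦⟧-⊕ a b)) (G.⟦⟧-⊕ _ _)
  ; ⟦⟧-⊗ = λ a b → trans (cong G.⟦_⟧ (F.⟦⟧-⊗ a b)) (G.⟦⟧-⊗ _ _)
  ; ⟦⟧-⊖ = λ a → trans (cong G.⟦_⟧ (F.⟦⟧-⊖ a)) (G.⟦⟧-⊖ _)
  ; ⟦⟧-0 = trans (cong G.⟦_⟧ F.⟦⟧-0) G.⟦⟧-0
  ; ⟦⟧-1 = trans (cong G.⟦_⟧ F.⟦⟧-1) G.⟦⟧-1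
  ; ⟦⟧-conj = λ a → trans (cong G.⟦_⟧ (F.⟦⟧-conj a)) (G.⟦⟧-conj _)
  ; ⟦⟧-injective = F.⟦⟧-injective ∘ G.⟦⟧-injective
  }
  where
  module F = StarHom f
  module G = StarHom g

module _ {S T : StarRing} (h : StarHom S T) {I : Set} (_≟_ : DecidableEquality I) {xs : List I} (unique : Unique xs) where
  private
    module S = StarRing S
    module T = StarRing T
    module SP = StarRingProperties S
    module TP = StarRingProperties T
  open StarHom h

  -- After the sums are exchanged, each y survives for the single index `g y`. With `w` constantly 1
  -- this reassembles W; with the powers of ζ_{2^k} it gives W_f.
  ∑-fibres : ∀ {X : Set} (ys : List X) (g : X → I) (t : X → S.Carrier) (w : I → T.Carrier) → (∀ y → g y ∈ xs) →
    TP.∑ xs (λ b → w b T.⊗ ⟦ SP.∑ ys (λ y → if does (g y ≟ b) then t y else S.0#) ⟧)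
      ≡ TP.∑ ys (λ y → w (g y) T.⊗ ⟦ t y ⟧)
  ∑-fibres ys g t w g∈ = begin
    TP.∑ xs (λ b → w b T.⊗ ⟦ SP.∑ ys (λ y → if does (g y ≟ b) then t y else S.0#) ⟧)
      ≡⟨ TP.∑-cong xs (λ b → trans (cong (w b T.⊗_) (⟦⟧-∑ ys _)) (trans (TP.∑-⊗ˡ ys _ _)
                              (TP.∑-cong ys (λ y → push-if (does (g y ≟ b)) (w b) (t y))))) ⟩
    TP.∑ xs (λ b → TP.∑ ys (λ y → if does (g y ≟ b) then w b T.⊗ ⟦ t y ⟧ else T.0#))
      ≡⟨ TP.∑-swap xs ys _ ⟩
    TP.∑ ys (λ y → TP.∑ xs (λ b → if does (g y ≟ b) then w b T.⊗ ⟦ t y ⟧ else T.0#))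
      ≡⟨ TP.∑-cong ys (λ y → TP.∑-single _≟_ (λ b → w b T.⊗ ⟦ t y ⟧) unique (g∈ y)) ⟩
    TP.∑ ys (λ y → w (g y) T.⊗ ⟦ t y ⟧) ∎
    where
    push-if : ∀ b v s → v T.⊗ ⟦ (if b then s else S.0#) ⟧ ≡ (if b then v T.⊗ ⟦ s ⟧ else T.0#)
    push-if true v s = refl
    push-if false v s = trans (cong (v T.⊗_) ⟦⟧-0) (T.zeroʳ v)

  -- Orthogonality is established in the small ring, where the hypotheses hold, and is carried by
  -- `h` to the ring that contains the phases. There the off-diagonal terms vanish and on the
  -- diagonal each phase meets its own conjugate.
  norm-twisted-∑ : (A : I → S.Carrier) (w : I → T.Carrier) → (∀ b → w b T.⊗ T.conj (w b) ≡ T.1#) →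
    (∀ b → b ∈ xs → A b S.⊗ S.conj (SP.∑ xs A) ≡ A b S.⊗ S.conj (A b)) →
    let twisted = TP.∑ xs (λ b → w b T.⊗ ⟦ A b ⟧) in
    twisted T.⊗ T.conj twisted ≡ ⟦ SP.∑ xs A S.⊗ S.conj (SP.∑ xs A) ⟧
  norm-twisted-∑ A w unit projects = begin
    twisted T.⊗ T.conj twisted
      ≡⟨ TP.∑-⊗-conj-∑ xs _ ⟩
    TP.∑ xs (λ b → TP.∑ xs (λ c → (w b T.⊗ ⟦ A b ⟧) T.⊗ T.conj (w c T.⊗ ⟦ A c ⟧)))
      ≡⟨ TP.∑-cong-∈ xs (λ b b∈ → trans (TP.∑-cong-∈ xs (term b b∈)) (TP.∑-single _≟_ (λ c → ⟦ A c S.⊗ S.conj (A c) ⟧) unique b∈)) ⟩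
    TP.∑ xs (λ b → ⟦ A b S.⊗ S.conj (A b) ⟧)
      ≡⟨ ⟦⟧-∑ xs _ ⟨
    ⟦ SP.∑ xs (λ b → A b S.⊗ S.conj (A b)) ⟧
      ≡⟨ cong ⟦_⟧ (SP.norm-∑ _≟_ unique A projects) ⟨
    ⟦ SP.∑ xs A S.⊗ S.conj (SP.∑ xs A) ⟧ ∎
    where
    open T.Solver using (solve; _:*_; _:=_)
    twisted : T.Carrier
    twisted = TP.∑ xs (λ b → w b T.⊗ ⟦ A b ⟧)

    rearrange : ∀ b c → (w b T.⊗ ⟦ A b ⟧) T.⊗ T.conj (w c T.⊗ ⟦ A c ⟧) ≡ (w b T.⊗ T.conj (w c)) T.⊗ ⟦ A b S.⊗ S.conj (A c) ⟧
    rearrange b c = begin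
      (w b T.⊗ ⟦ A b ⟧) T.⊗ T.conj (w c T.⊗ ⟦ A c ⟧)
        ≡⟨ cong ((w b T.⊗ ⟦ A b ⟧) T.⊗_) (trans (T.conj-⊗ _ _) (cong (T.conj (w c) T.⊗_) (sym (⟦⟧-conj _)))) ⟩
      (w b T.⊗ ⟦ A b ⟧) T.⊗ (T.conj (w c) T.⊗ ⟦ S.conj (A c) ⟧)
        ≡⟨ solve 4 (λ a b c d → (a :* b) :* (c :* d) := (a :* c) :* (b :* d)) refl _ _ _ _ ⟩
      (w b T.⊗ T.conj (w c)) T.⊗ (⟦ A b ⟧ T.⊗ ⟦ S.conj (A c) ⟧)
        ≡⟨ cong ((w b T.⊗ T.conj (w c)) T.⊗_) (⟦⟧-⊗ _ _) ⟨
      (w b T.⊗ T.conj (w c)) T.⊗ ⟦ A b S.⊗ S.conj (A c) ⟧ ∎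

    term : ∀ b → b ∈ xs → ∀ c → c ∈ xs →
      (w b T.⊗ ⟦ A b ⟧) T.⊗ T.conj (w c T.⊗ ⟦ A c ⟧) ≡ (if does (b ≟ c) then ⟦ A c S.⊗ S.conj (A c) ⟧ else T.0#)
    term b b∈ c c∈ with b ≟ c
    ... | yes refl = trans (rearrange b b) (trans (cong (T._⊗ _) (unit b)) (T.*-identityˡ _))
    ... | no b≢c = trans (rearrange b c)
      (trans (cong (λ t → (w b T.⊗ T.conj (w c)) T.⊗ ⟦ t ⟧) (SP.orthogonal _≟_ unique A projects b∈ c∈ b≢c))
             (trans (cong ((w b T.⊗ T.conj (w c)) T.⊗_) ⟦⟧-0) (T.zeroʳ _)))

-- Embeddings in the tower and powers of ζ.

module _ (S : StarRing) where
  open StarRing S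
  private
    module D = StarRing (double S)

  step : StarHom S (double S)
  step = record
    { ⟦_⟧ = _, 0#
    ; ⟦⟧-⊕ = λ a b → cong (a ⊕ b ,_) (sym (+-identityˡ 0#))
    ; ⟦⟧-⊗ = λ a b → cong₂ _,_
        (sym (trans (cong (a ⊗ b ⊕_) (trans (cong (ζ ⊗_) (zeroˡ 0#)) (zeroʳ ζ))) (+-identityʳ _)))
        (sym (trans (cong₂ _⊕_ (zeroʳ a) (zeroˡ b)) (+-identityˡ 0#)))
    ; ⟦⟧-⊖ = λ a → cong (⊖ a ,_) (sym -0#≈0#)
    ; ⟦⟧-0 = refl
    ; ⟦⟧-1 = refl
    ; ⟦⟧-conj = λ a → cong (conj a ,_) (sym (trans (cong (conj ζ ⊗_) conj-0) (zeroʳ _)))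
    ; ⟦⟧-injective = cong proj₁
    }

  ζ-⊗-pair : ∀ a → D.ζ D.⊗ (a , 0#) ≡ (0# , a)
  ζ-⊗-pair a = cong₂ _,_
    (trans (cong₂ _⊕_ (zeroˡ a) (trans (cong (ζ ⊗_) (zeroʳ 1#)) (zeroʳ ζ))) (+-identityˡ 0#))
    (trans (cong₂ _⊕_ (zeroˡ 0#) (*-identityˡ a)) (+-identityˡ a))

  ζ↑2 : D.ζ D.↑ 2 ≡ (ζ , 0#)
  ζ↑2 = trans (cong (D.ζ D.⊗_) (ζ-⊗-pair 1#)) (cong₂ _,_
    (trans (cong₂ _⊕_ (zeroˡ 0#) (trans (cong (ζ ⊗_) (*-identityˡ 1#)) (*-identityʳ ζ))) (+-identityˡ ζ))
    (trans (cong₂ _⊕_ (zeroˡ 1#) (zeroʳ 1#)) (+-identityˡ 0#)))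

  ζ↑even : ∀ e → D.ζ D.↑ (2 * e) ≡ (ζ ↑ e , 0#)
  ζ↑even e = begin
    D.ζ D.↑ (2 * e)     ≡⟨ D.^-assocʳ D.ζ 2 e ⟨
    (D.ζ D.↑ 2) D.↑ e   ≡⟨ cong (D._↑ e) ζ↑2 ⟩
    (ζ , 0#) D.↑ e      ≡⟨ StarHom.⟦⟧-↑ step ζ e ⟨
    (ζ ↑ e , 0#)        ∎

  ζ↑odd : ∀ e → D.ζ D.↑ suc (2 * e) ≡ (0# , ζ ↑ e)
  ζ↑odd e = trans (cong (D.ζ D.⊗_) (ζ↑even e)) (ζ-⊗-pair (ζ ↑ e))

embed : ∀ d j → StarHom (tower j) (tower (d + j))
embed zero j = id-hom
embed (suc d) j = step (tower (d + j)) ∘ₕ embed d j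

-- Each doubling makes the old `ζ` the square of the new one, which doubles the exponent.
embed-ζ : ∀ d j → StarHom.⟦_⟧ (embed d j) (StarRing.ζ (tower j)) ≡ StarRing._↑_ (tower (d + j)) (StarRing.ζ (tower (d + j))) (2 ^ d)
embed-ζ zero j = sym (StarRing.*-identityʳ (tower j) _)
embed-ζ (suc d) j = trans (cong (_, StarRing.0# (tower (d + j))) (embed-ζ d j)) (sym (ζ↑even (tower (d + j)) (2 ^ d)))

module Tower (j : ℕ) where
  open StarRing (tower j) public
  open StarRingProperties (tower j) public

ζ↑half : ∀ j → let open Tower j in ζ ↑ (2 ^ j) ≡ ⊖ 1#
ζ↑half zero = refl
ζ↑half (suc j) = trans (ζ↑even (tower j) (2 ^ j)) (trans (cong (_, 0#) (ζ↑half j)) (cong (⊖ 1# ,_) (sym -0#≈0#)))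
  where open Tower j

module _ (j : ℕ) where
  open Tower j

  private
    instance
      2^K≢0 : NonZero (2 ^ suc j)
      2^K≢0 = m^n≢0 2 (suc j)

  ζ-order : ζ ↑ (2 ^ suc j) ≡ 1#
  ζ-order = begin
    ζ ↑ (2 * 2 ^ j)   ≡⟨ cong (ζ ↑_) (ℕP.*-comm 2 (2 ^ j)) ⟩
    ζ ↑ (2 ^ j * 2)   ≡⟨ ^-assocʳ ζ (2 ^ j) 2 ⟨
    (ζ ↑ (2 ^ j)) ↑ 2 ≡⟨ cong (_↑ 2) (ζ↑half j) ⟩
    ⊖ 1# ⊗ (⊖ 1# ⊗ 1#) ≡⟨ cong (⊖ 1# ⊗_) (*-identityʳ _) ⟩
    ⊖ 1# ⊗ ⊖ 1#       ≡⟨ sign-xor true true ⟨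
    1#                ∎

  ζ↑-mod : ∀ e → ζ ↑ modPow2 (suc j) e ≡ ζ ↑ e
  ζ↑-mod e = sym (begin
    ζ ↑ e                                  ≡⟨ cong (ζ ↑_) (m≡m%n+[m/n]*n e N) ⟩
    ζ ↑ (e % N + e / N * N)                ≡⟨ ^-homo-* ζ (e % N) _ ⟩
    ζ ↑ (e % N) ⊗ ζ ↑ (e / N * N)          ≡⟨ cong (λ t → ζ ↑ (e % N) ⊗ ζ ↑ t) (ℕP.*-comm (e / N) N) ⟩
    ζ ↑ (e % N) ⊗ ζ ↑ (N * (e / N))        ≡⟨ cong (ζ ↑ (e % N) ⊗_) (^-assocʳ ζ N (e / N)) ⟨
    ζ ↑ (e % N) ⊗ (ζ ↑ N) ↑ (e / N)        ≡⟨ cong (λ t → ζ ↑ (e % N) ⊗ t ↑ (e / N)) ζ-order ⟩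
    ζ ↑ (e % N) ⊗ 1# ↑ (e / N)             ≡⟨ cong (ζ ↑ (e % N) ⊗_) (1-↑ (e / N)) ⟩
    ζ ↑ (e % N) ⊗ 1#                       ≡⟨ *-identityʳ _ ⟩
    ζ ↑ (e % N)                            ∎)
    where
    N : ℕ
    N = 2 ^ suc j

  -- Both sides are inverse to ζ^e. The natural-number exponent is the one used in `absSq`; when e
  -- is divisible by 2^K it is the full order 2^K, which still gives 1.
  conj-ζ↑ : ∀ e → conj (ζ ↑ e) ≡ ζ ↑ (2 ^ suc j ∸ modPow2 (suc j) e)
  conj-ζ↑ e = begin
    conj (ζ ↑ e)                     ≡⟨ cong conj (ζ↑-mod e) ⟨
    conj x                           ≡⟨ *-identityˡ _ ⟨
    1# ⊗ conj x                      ≡⟨ cong (_⊗ conj x) yx≡1 ⟨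
    (y ⊗ x) ⊗ conj x                 ≡⟨ *-assoc _ _ _ ⟩
    y ⊗ (x ⊗ conj x)                 ≡⟨ cong (y ⊗_) (↑-unitary (modPow2 (suc j) e) ζ-unitary) ⟩
    y ⊗ 1#                           ≡⟨ *-identityʳ y ⟩
    y                                ∎
    where
    x y : Carrier
    x = ζ ↑ modPow2 (suc j) e
    y = ζ ↑ (2 ^ suc j ∸ modPow2 (suc j) e)

    yx≡1 : y ⊗ x ≡ 1#
    yx≡1 = begin
      y ⊗ x ≡⟨ ^-homo-* ζ (2 ^ suc j ∸ modPow2 (suc j) e) (modPow2 (suc j) e) ⟨
      ζ ↑ (2 ^ suc j ∸ modPow2 (suc j) e + modPow2 (suc j) e)
            ≡⟨ cong (ζ ↑_) (ℕP.m∸n+n≡m (ℕP.<⇒≤ (m%n<n e (2 ^ suc j)))) ⟩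
      ζ ↑ (2 ^ suc j) ≡⟨ ζ-order ⟩
      1# ∎

-- Coefficient functions as elements of the tower.

data Parity : ℕ → Set where
  even : ∀ m → Parity (2 * m)
  odd : ∀ m → Parity (suc (2 * m))

parity : ∀ n → Parity n
parity zero = even 0
parity (suc n) with parity n
... | even m = odd m
... | odd m = subst Parity (ℕP.*-suc 2 m) (even (suc m))

-- ζ_{2^{j+2}}^{2i} = ζ_{2^{j+1}}^i, so the two components in the doubling are the even and the odd coefficients.
fromCoeffs : ∀ j → Cyc → StarRing.Carrier (tower j)
fromCoeffs zero a = a 0
fromCoeffs (suc j) a = fromCoeffs j (λ i → a (2 * i)) , fromCoeffs j (λ i → a (suc (2 * i)))

2*-mono-< : ∀ {i N} → i < N → 2 * i < 2 * N
2*-mono-< = ℕP.*-monoʳ-< 2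

suc-2*-mono-< : ∀ {i N} → i < N → suc (2 * i) < 2 * N
suc-2*-mono-< {i} {N} i<N = ℕP.≤-trans (ℕP.≤-reflexive (sym (ℕP.*-suc 2 i))) (ℕP.*-monoʳ-≤ 2 i<N)

fromCoeffs-cong : ∀ j {a b} → a ≈[ suc j ] b → fromCoeffs j a ≡ fromCoeffs j b
fromCoeffs-cong zero a≈b = a≈b 0 (ℕP.≤-refl)
fromCoeffs-cong (suc j) a≈b = cong₂ _,_
  (fromCoeffs-cong j (λ i i< → a≈b (2 * i) (2*-mono-< i<)))
  (fromCoeffs-cong j (λ i i< → a≈b (suc (2 * i)) (suc-2*-mono-< i<)))

fromCoeffs-injective : ∀ j {a b} → fromCoeffs j a ≡ fromCoeffs j b → a ≈[ suc j ] b
fromCoeffs-injective zero eq zero _ = eq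
fromCoeffs-injective zero eq (suc i) (s≤s ())
fromCoeffs-injective (suc j) eq i i< with parity i
... | even m = fromCoeffs-injective j (cong proj₁ eq) m (ℕP.*-cancelˡ-< 2 _ _ i<)
... | odd m = fromCoeffs-injective j (cong proj₂ eq) m (ℕP.*-cancelˡ-< 2 _ _ (ℕP.<-trans (ℕP.n<1+n _) i<))

fromCoeffs-cong-∀ : ∀ j {a b} → (∀ i → a i ≡ b i) → fromCoeffs j a ≡ fromCoeffs j b
fromCoeffs-cong-∀ j a≡b = fromCoeffs-cong j (λ i _ → a≡b i)

fromCoeffs-+ : ∀ j a b → fromCoeffs j (λ i → a i ℤ.+ b i) ≡ StarRing._⊕_ (tower j) (fromCoeffs j a) (fromCoeffs j b)
fromCoeffs-+ zero a b = refl
fromCoeffs-+ (suc j) a b = cong₂ _,_ (fromCoeffs-+ j _ _) (fromCoeffs-+ j _ _)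

fromCoeffs-neg : ∀ j a → fromCoeffs j (λ i → ℤ.- a i) ≡ StarRing.⊖_ (tower j) (fromCoeffs j a)
fromCoeffs-neg zero a = refl
fromCoeffs-neg (suc j) a = cong₂ _,_ (fromCoeffs-neg j _) (fromCoeffs-neg j _)

fromCoeffs-0 : ∀ j → fromCoeffs j (λ _ → + 0) ≡ StarRing.0# (tower j)
fromCoeffs-0 zero = refl
fromCoeffs-0 (suc j) = cong₂ _,_ (fromCoeffs-0 j) (fromCoeffs-0 j)

fromCoeffs-sgn : ∀ j b a → let open Tower j in fromCoeffs j (λ i → sgn b ℤ.* a i) ≡ sign b ⊗ fromCoeffs j a
fromCoeffs-sgn j false a = trans (fromCoeffs-cong-∀ j (λ i → ℤP.*-identityˡ (a i))) (sym (Tower.*-identityˡ j _))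
fromCoeffs-sgn j true a = trans (fromCoeffs-cong-∀ j (λ i → ℤP.-1*i≡-i (a i)))
  (trans (fromCoeffs-neg j a) (sym (Tower.-1*x≈-x j _)))

fromCoeffs-sum : ∀ j {A : Set} (g : A → Cyc) xs →
  fromCoeffs j (λ i → sumℤ (λ x → g x i) xs) ≡ Tower.∑ j xs (λ x → fromCoeffs j (g x))
fromCoeffs-sum j g [] = fromCoeffs-0 j
fromCoeffs-sum j g (x ∷ xs) = trans (fromCoeffs-+ j _ _) (cong (Tower._⊕_ j _) (fromCoeffs-sum j g xs))

-- Through this, the value 2^m v² in `AbsIs` means the same over ℤ_{2^ℓ} and over ℤ_{2^k}.
fromCoeffs-const : ∀ d j c → fromCoeffs (d + j) (const c) ≡ StarHom.⟦_⟧ (embed d j) (fromCoeffs j (const c))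
fromCoeffs-const zero j c = refl
fromCoeffs-const (suc d) j c = cong₂ _,_
  (trans (fromCoeffs-cong-∀ (d + j) const-even) (fromCoeffs-const d j c))
  (fromCoeffs-0 (d + j))
  where
  const-even : ∀ i → const c (2 * i) ≡ const c i
  const-even zero = refl
  const-even (suc i) = refl

fromCoeffs-const-0 : ∀ j → fromCoeffs j (const (+ 0)) ≡ StarRing.0# (tower j)
fromCoeffs-const-0 j = trans (fromCoeffs-cong-∀ j (λ { zero → refl ; (suc i) → refl })) (fromCoeffs-0 j)

δ : ℕ → ℕ → ℤ
δ a b = if does (a ≟ b) then + 1 else + 0

-- A difference of deltas splits cleanly into even and odd indices, unlike nested tests. The two
-- forms could differ only if both tests succeeded, which would need `half K` to be 0.
zpow-δ : ∀ K e i → zpow K e i ≡ δ (modPow2 K e) i ℤ.- δ (modPow2 K e) (i + half K)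
zpow-δ K e i with does (modPow2 K e ≟ i) in p | does (modPow2 K e ≟ i + half K) in q
... | true | true = ⊥-elim (ℕP.m≢1+m+n i (begin
    i                          ≡⟨ equal p ⟨
    modPow2 K e                ≡⟨ equal q ⟩
    i + half K                 ≡⟨ cong (λ t → i + t) (ℕP.suc-pred (half K) {{m^n≢0 2 (K ∸ 1)}}) ⟨
    i + suc (pred (half K))    ≡⟨ ℕP.+-suc i _ ⟩
    suc (i + pred (half K))    ∎))
  where
  equal : ∀ {a b} → does (a ≟ b) ≡ true → a ≡ b
  equal {a} {b} eq = ℕP.≡ᵇ⇒≡ a b (subst T (sym eq) tt)
... | true | false = refl
... | false | true = refl
... | false | false = refl

δ-no : ∀ {a b} → a ≢ b → δ a b ≡ + 0
δ-no {a} {b} a≢b = cong (if_then + 1 else + 0) (dec-false (a ≟ b) a≢b)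

δ-2* : ∀ a b → δ (2 * a) (2 * b) ≡ δ a b
δ-2* a b = cong (if_then + 1 else + 0)
  (does-⇔ (mk⇔ (ℕP.*-cancelˡ-≡ a b 2) (cong (2 *_))) (2 * a ≟ 2 * b) (a ≟ b))

δ-even-odd : ∀ a b → δ (2 * a) (suc (2 * b)) ≡ + 0
δ-even-odd a b = δ-no (ℕP.even≢odd a b)

δ-odd-even : ∀ a b → δ (suc (2 * a)) (2 * b) ≡ + 0
δ-odd-even a b = δ-no (λ eq → ℕP.even≢odd b a (sym eq))

2*-shift : ∀ i j → 2 * i + 2 ^ suc j ≡ 2 * (i + 2 ^ j)
2*-shift i j = sym (ℕP.*-distribˡ-+ 2 i (2 ^ j))

-- Induction by the parity of e: the exponents 2m and 2m + 1 occupy only the even or only the odd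
-- coefficients, and there the shift by 2^{j+1} becomes a shift by 2^j.
fromCoeffs-δ : ∀ j e → e < 2 ^ suc j → fromCoeffs j (λ i → δ e i ℤ.- δ e (i + 2 ^ j)) ≡ Tower._↑_ j (Tower.ζ j) e
fromCoeffs-δ zero zero _ = refl
fromCoeffs-δ zero (suc zero) _ = refl
fromCoeffs-δ zero (suc (suc e)) (s≤s (s≤s ()))
fromCoeffs-δ (suc j) e e< with parity e
... | even m = trans (cong₂ _,_
    (trans (fromCoeffs-cong-∀ j (λ i → cong₂ ℤ._-_ (δ-2* m i) (trans (cong (δ (2 * m)) (2*-shift i j)) (δ-2* m (i + 2 ^ j)))))
           (fromCoeffs-δ j m (ℕP.*-cancelˡ-< 2 _ _ e<)))
    (trans (fromCoeffs-cong-∀ j (λ i → cong₂ ℤ._-_ (δ-even-odd m i)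
              (trans (cong (δ (2 * m) ∘ suc) (2*-shift i j)) (δ-even-odd m (i + 2 ^ j)))))
           (fromCoeffs-0 j)))
  (sym (ζ↑even (tower j) m))
... | odd m = trans (cong₂ _,_
    (trans (fromCoeffs-cong-∀ j (λ i → cong₂ ℤ._-_ (δ-odd-even m i)
              (trans (cong (δ (suc (2 * m))) (2*-shift i j)) (δ-odd-even m (i + 2 ^ j)))))
           (fromCoeffs-0 j))
    (trans (fromCoeffs-cong-∀ j (λ i → cong₂ ℤ._-_ (δ-2* m i) (trans (cong (δ (2 * m)) (2*-shift i j)) (δ-2* m (i + 2 ^ j)))))
           (fromCoeffs-δ j m (ℕP.*-cancelˡ-< 2 _ _ (ℕP.<-trans (ℕP.n<1+n _) e<)))))
  (sym (ζ↑odd (tower j) m))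

fromCoeffs-zpow : ∀ j e → fromCoeffs j (zpow (suc j) e) ≡ Tower._↑_ j (Tower.ζ j) e
fromCoeffs-zpow j e = begin
  fromCoeffs j (zpow (suc j) e)                                ≡⟨ fromCoeffs-cong-∀ j (zpow-δ (suc j) e) ⟩
  fromCoeffs j (λ i → δ e′ i ℤ.- δ e′ (i + 2 ^ j))             ≡⟨ fromCoeffs-δ j e′ (m%n<n e (2 ^ suc j) {{m^n≢0 2 (suc j)}}) ⟩
  Tower._↑_ j (Tower.ζ j) e′                                   ≡⟨ ζ↑-mod j e ⟩
  Tower._↑_ j (Tower.ζ j) e                                    ∎
  where
  e′ : ℕ
  e′ = modPow2 (suc j) e

-- The Walsh transform in the tower.

module _ {n : ℕ} (j : ℕ) where
  open Tower j

  walsh : ℕ → (V n → ℕ) → V n → Carrier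
  walsh s h u = ∑ (allV n) (λ x → sign (inner u x) ⊗ ζ ↑ (s * h x))

  fromCoeffs-Wt : ∀ s h u → fromCoeffs j (Wt n (suc j) s h u) ≡ walsh s h u
  fromCoeffs-Wt s h u = trans (fromCoeffs-sum j _ (allV n)) (∑-cong (allV n) (λ x →
    trans (fromCoeffs-sgn j (inner u x) _) (cong (sign (inner u x) ⊗_) (fromCoeffs-zpow j (s * h x)))))

  fromCoeffs-absSq : ∀ s h u → fromCoeffs j (absSq n (suc j) s h u) ≡ walsh s h u ⊗ conj (walsh s h u)
  fromCoeffs-absSq s h u = begin
    fromCoeffs j (absSq n (suc j) s h u)
      ≡⟨ trans (fromCoeffs-sum j _ (allV n)) (∑-cong (allV n) (λ x → fromCoeffs-sum j _ (allV n))) ⟩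
    ∑ (allV n) (λ x → ∑ (allV n) (λ y → fromCoeffs j (λ i → sgn (inner u x xor inner u y) ℤ.* zpow (suc j) (e x y) i)))
      ≡⟨ ∑-cong (allV n) (λ x → ∑-cong (allV n) (λ y → term x y)) ⟩
    ∑ (allV n) (λ x → ∑ (allV n) (λ y → t x ⊗ conj (t y)))
      ≡⟨ ∑-⊗-conj-∑ (allV n) t ⟨
    walsh s h u ⊗ conj (walsh s h u) ∎
    where
    open Solver using (solve; _:*_; _:=_)
    e : V n → V n → ℕ
    e x y = s * h x + (2 ^ suc j ∸ modPow2 (suc j) (s * h y))

    t : V n → Carrier
    t x = sign (inner u x) ⊗ ζ ↑ (s * h x)

    term : ∀ x y → fromCoeffs j (λ i → sgn (inner u x xor inner u y) ℤ.* zpow (suc j) (e x y) i) ≡ t x ⊗ conj (t y)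
    term x y = begin
      fromCoeffs j (λ i → sgn (inner u x xor inner u y) ℤ.* zpow (suc j) (e x y) i)
        ≡⟨ trans (fromCoeffs-sgn j (inner u x xor inner u y) _) (cong (sign (inner u x xor inner u y) ⊗_) (fromCoeffs-zpow j (e x y))) ⟩
      sign (inner u x xor inner u y) ⊗ ζ ↑ e x y
        ≡⟨ cong₂ _⊗_ (sign-xor (inner u x) (inner u y))
                     (trans (^-homo-* ζ (s * h x) _) (cong (ζ ↑ (s * h x) ⊗_) (sym (conj-ζ↑ j (s * h y))))) ⟩
      (sign (inner u x) ⊗ sign (inner u y)) ⊗ (ζ ↑ (s * h x) ⊗ conj (ζ ↑ (s * h y)))
        ≡⟨ solve 4 (λ a b c d → (a :* b) :* (c :* d) := (a :* c) :* (b :* d)) refl _ _ _ _ ⟩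
      t x ⊗ (sign (inner u y) ⊗ conj (ζ ↑ (s * h y)))
        ≡⟨ cong (λ z → t x ⊗ (z ⊗ conj (ζ ↑ (s * h y)))) (conj-sign (inner u y)) ⟨
      t x ⊗ (conj (sign (inner u y)) ⊗ conj (ζ ↑ (s * h y)))
        ≡⟨ cong (t x ⊗_) (conj-⊗ _ _) ⟨
      t x ⊗ conj (t y) ∎

-- Digits in base 2^ℓ.

module _ (N M : ℕ) .{{_ : NonZero N}} .{{_ : NonZero M}} where

  private
    instance
      NM≢0 : NonZero (N * M)
      NM≢0 = ℕP.m*n≢0 N M

  %-*-split : ∀ a → a % (N * M) ≡ a % M + (a / M) % N * M
  %-*-split a = begin
    a % (N * M)                                   ≡⟨ m≡m%n+[m/n]*n (a % (N * M)) M ⟩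
    a % (N * M) % M + a % (N * M) / M * M         ≡⟨ cong₂ (λ s t → s + t * M) (m∣n⇒o%n%m≡o%m M (N * M) a (n∣m*n N)) (m%[n*o]/o≡m/o%n a N M) ⟩
    a % M + (a / M) % N * M                       ∎

2^≢0 : ∀ d → NonZero (2 ^ d)
2^≢0 d = m^n≢0 2 d

highBits : ℕ → ℕ → ℕ
highBits d a = _/_ a (2 ^ d) {{2^≢0 d}}

module _ (ℓ : ℕ) where

  nthDigit : ℕ → ℕ → ℕ
  nthDigit i a = modPow2 ℓ (highBits (i * ℓ) a)

  modPow2-suc : ∀ q a → modPow2 (suc q * ℓ) a ≡ modPow2 (q * ℓ) a + nthDigit q a * 2 ^ (q * ℓ)
  modPow2-suc q a = trans
    (%-congʳ {{2^≢0 (suc q * ℓ)}} {{ℕP.m*n≢0 (2 ^ ℓ) (2 ^ (q * ℓ)) {{2^≢0 ℓ}} {{2^≢0 (q * ℓ)}}}} (ℕP.^-distribˡ-+-* 2 ℓ (q * ℓ)))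
    (%-*-split (2 ^ ℓ) (2 ^ (q * ℓ)) {{2^≢0 ℓ}} {{2^≢0 (q * ℓ)}} a)

  digits-determine : ∀ q {a b} → (∀ i → i < q → nthDigit i a ≡ nthDigit i b) → modPow2 (q * ℓ) a ≡ modPow2 (q * ℓ) b
  digits-determine zero {a} {b} _ = trans (n%1≡0 a) (sym (n%1≡0 b))
  digits-determine (suc q) {a} {b} eq = begin
    modPow2 (suc q * ℓ) a                           ≡⟨ modPow2-suc q a ⟩
    modPow2 (q * ℓ) a + nthDigit q a * 2 ^ (q * ℓ)  ≡⟨ cong₂ (λ s t → s + t * 2 ^ (q * ℓ))
                                                         (digits-determine q (λ i i<q → eq i (ℕP.m<n⇒m<1+n i<q)))
                                                         (eq q (ℕP.n<1+n q)) ⟩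
    modPow2 (q * ℓ) b + nthDigit q b * 2 ^ (q * ℓ)  ≡⟨ modPow2-suc q b ⟨
    modPow2 (suc q * ℓ) b                           ∎

  -- The i-th digit depends only on the residue modulo 2^{(i+1)ℓ}, which divides 2^{qℓ}.
  nthDigit-modPow2 : ∀ q i a → i < q → nthDigit i (modPow2 (q * ℓ) a) ≡ nthDigit i a
  nthDigit-modPow2 q i a i<q = begin
    nthDigit i (modPow2 (q * ℓ) a)            ≡⟨ nthDigit-% (modPow2 (q * ℓ) a) ⟨
    highBits (i * ℓ) (modPow2 (q * ℓ) a %N)   ≡⟨ cong (highBits (i * ℓ)) (m∣n⇒o%n%m≡o%m N (2 ^ (q * ℓ)) a {{N≢0}} {{2^≢0 (q * ℓ)}} N∣) ⟩
    highBits (i * ℓ) (a %N)                   ≡⟨ nthDigit-% a ⟩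
    nthDigit i a                              ∎
    where
    N : ℕ
    N = 2 ^ ℓ * 2 ^ (i * ℓ)

    N≢0 : NonZero N
    N≢0 = ℕP.m*n≢0 (2 ^ ℓ) (2 ^ (i * ℓ)) {{2^≢0 ℓ}} {{2^≢0 (i * ℓ)}}

    _%N : ℕ → ℕ
    b %N = _%_ b N {{N≢0}}

    nthDigit-% : ∀ b → highBits (i * ℓ) (b %N) ≡ nthDigit i b
    nthDigit-% b = m%[n*o]/o≡m/o%n b (2 ^ ℓ) (2 ^ (i * ℓ)) {{2^≢0 ℓ}} {{2^≢0 (i * ℓ)}} {{N≢0}}

    N∣ : N ∣ 2 ^ (q * ℓ)
    N∣ = subst (_∣ 2 ^ (q * ℓ)) (ℕP.^-distribˡ-+-* 2 ℓ (i * ℓ)) (2^-mono-∣ (ℕP.*-monoˡ-≤ ℓ i<q))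
      where
      2^-mono-∣ : ∀ {s t} → s ≤ t → 2 ^ s ∣ 2 ^ t
      2^-mono-∣ {s} {t} s≤t = subst (λ e → 2 ^ s ∣ 2 ^ e) (ℕP.m+[n∸m]≡n s≤t)
        (subst (2 ^ s ∣_) (sym (ℕP.^-distribˡ-+-* 2 s (t ∸ s))) (m∣m*n _))

toℕ-toZ : ∀ j a → toℕ (toZ j a) ≡ modPow2 j a
toℕ-toZ j a = FinP.toℕ-fromℕ< _

toℕ-digit : ∀ {n} k ℓ (f : V n → Fin (2 ^ k)) i x → toℕ (digit k ℓ f i x) ≡ nthDigit ℓ i (toℕ (f x))
toℕ-digit k ℓ f i x = toℕ-toZ ℓ _

-- The classes of f and the transfer of levels.

module Main (n j q : ℕ) where
  -- Here r = q + 1, and d = (r-1)ℓ counts the bits below the top digit. Spelling k as `suc (d + j)`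
  -- makes ℤ[ζ_{2^k}] literally `tower (d + j)`, the target of `embed d j`.
  ℓ d k : ℕ
  ℓ = suc j
  d = q * ℓ
  k = suc (d + j)

  private
    module S = Tower j
    module T = Tower (d + j)

  open StarHom (embed d j)

  ⟦ζ↑⟧ : ∀ e → ⟦ S.ζ S.↑ (1 * e) ⟧ ≡ T.ζ T.↑ (2 ^ d * e)
  ⟦ζ↑⟧ e = begin
    ⟦ S.ζ S.↑ (1 * e) ⟧       ≡⟨ cong (λ e → ⟦ S.ζ S.↑ e ⟧) (ℕP.*-identityˡ e) ⟩
    ⟦ S.ζ S.↑ e ⟧             ≡⟨ ⟦⟧-↑ S.ζ e ⟩
    ⟦ S.ζ ⟧ T.↑ e             ≡⟨ cong (T._↑ e) (embed-ζ d j) ⟩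
    (T.ζ T.↑ (2 ^ d)) T.↑ e   ≡⟨ T.^-assocʳ T.ζ (2 ^ d) e ⟩
    T.ζ T.↑ (2 ^ d * e)       ∎

  -- The conclusion compares both absolute values inside ℤ[ζ_{2^k}], where ζ_{2^ℓ} is the power 2^d
  -- of the generator.
  walsh-embed : ∀ h (u : V n) → walsh (d + j) (2 ^ d) h u ≡ ⟦ walsh j 1 h u ⟧
  walsh-embed h u = sym (trans (⟦⟧-∑ (allV n) _) (T.∑-cong (allV n) (λ x →
    trans (⟦⟧-⊗ _ _) (cong₂ T._⊗_ (⟦⟧-sign (inner u x)) (⟦ζ↑⟧ (h x))))))

  module _ (f : V n → Fin (2 ^ k)) where

    low : V n → ℕ
    low x = modPow2 d (toℕ (f x))

    top : V n → ℕ
    top x = toℕ (digit k ℓ f q x)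

    f-split : ∀ x → toℕ (f x) ≡ low x + 2 ^ d * top x
    f-split x = begin
      toℕ (f x)                                 ≡⟨ m≡m%n+[m/n]*n (toℕ (f x)) (2 ^ d) {{2^≢0 d}} ⟩
      low x + highBits d (toℕ (f x)) * 2 ^ d         ≡⟨ cong (λ t → low x + t) (ℕP.*-comm _ (2 ^ d)) ⟩
      low x + 2 ^ d * highBits d (toℕ (f x))       ≡⟨ cong (λ t → low x + 2 ^ d * t) (trans (toℕ-digit k ℓ f q x) (m<n⇒m%n≡m {{2^≢0 ℓ}} top<)) ⟨
      low x + 2 ^ d * top x                     ∎
      where
      2^k≡ : 2 ^ k ≡ 2 ^ ℓ * 2 ^ d
      2^k≡ = trans (cong (2 ^_) (cong suc (ℕP.+-comm d j))) (ℕP.^-distribˡ-+-* 2 ℓ d)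

      -- The bound f(x) < 2^k makes the reduction modulo 2^ℓ inside `digit` harmless for the top
      -- digit.
      top< : highBits d (toℕ (f x)) < 2 ^ ℓ
      top< = m<n*o⇒m/o<n {{2^≢0 d}} (subst (toℕ (f x) <_) 2^k≡ (FinP.toℕ<n (f x)))

    classes : List ℕ
    classes = upTo (2 ^ d)

    low∈ : ∀ x → low x ∈ classes
    low∈ x = ∈-upTo⁺ (m%n<n (toℕ (f x)) (2 ^ d) {{2^≢0 d}})

    module _ (u : V n) where

      t : V n → S.Carrier
      t x = S.sign (inner u x) S.⊗ S.ζ S.↑ (1 * top x)

      -- This is A_b of the overview, and `rest b` is D. Both run over all x with zeros inserted, so
      -- that W = D + A holds term by term.
      part : ℕ → S.Carrier
      part b = S.∑ (allV n) (λ x → if does (low x ≟ b) then t x else S.0#)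

      rest : ℕ → S.Carrier
      rest b = S.∑ (allV n) (λ x → if does (low x ≟ b) then S.0# else t x)

      walsh-split : ∀ b → walsh j 1 top u ≡ rest b S.⊕ part b
      walsh-split b = trans (S.∑-cong (allV n) (λ x → S.split-if (does (low x ≟ b)) (t x))) (S.∑-⊕ (allV n) _ _)

      walsh-top : S.∑ classes part ≡ walsh j 1 top u
      walsh-top = begin
        S.∑ classes part
          ≡⟨ S.∑-cong classes (λ b → S.*-identityˡ (part b)) ⟨
        S.∑ classes (λ b → S.1# S.⊗ part b)
          ≡⟨ ∑-fibres id-hom _≟_ (upTo⁺ (2 ^ d)) (allV n) low t (λ _ → S.1#) low∈ ⟩
        S.∑ (allV n) (λ x → S.1# S.⊗ t x)
          ≡⟨ S.∑-cong (allV n) (λ x → S.*-identityˡ (t x)) ⟩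
        walsh j 1 top u ∎

      -- By `f-split`, ζ_{2^k}^{f(x)} is ζ_{2^k}^{low x} times the image of ζ_{2^ℓ}^{top x}, and the
      -- first factor is constant on a class.
      walsh-f : T.∑ classes (λ b → T.ζ T.↑ b T.⊗ ⟦ part b ⟧) ≡ walsh (d + j) 1 (toℕ ∘ f) u
      walsh-f = trans (∑-fibres (embed d j) _≟_ (upTo⁺ (2 ^ d)) (allV n) low t (T.ζ T.↑_) low∈)
        (T.∑-cong (allV n) (λ x → begin
          T.ζ T.↑ low x T.⊗ ⟦ t x ⟧
            ≡⟨ cong (T.ζ T.↑ low x T.⊗_) (trans (⟦⟧-⊗ _ _) (cong₂ T._⊗_ (⟦⟧-sign (inner u x)) (⟦ζ↑⟧ (top x)))) ⟩
          T.ζ T.↑ low x T.⊗ (T.sign (inner u x) T.⊗ T.ζ T.↑ (2 ^ d * top x))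
            ≡⟨ solve 3 (λ a b c → a :* (b :* c) := b :* (a :* c)) refl _ _ _ ⟩
          T.sign (inner u x) T.⊗ (T.ζ T.↑ low x T.⊗ T.ζ T.↑ (2 ^ d * top x))
            ≡⟨ cong (T.sign (inner u x) T.⊗_) (T.^-homo-* T.ζ (low x) _) ⟨
          T.sign (inner u x) T.⊗ T.ζ T.↑ (low x + 2 ^ d * top x)
            ≡⟨ cong (λ e → T.sign (inner u x) T.⊗ T.ζ T.↑ e) (trans (ℕP.*-identityˡ _) (f-split x)) ⟨
          T.sign (inner u x) T.⊗ T.ζ T.↑ (1 * toℕ (f x)) ∎))
        where
        open T.Solver using (solve; _:*_; _:=_)

    -- The point α^{(0)} at which the hypothesis is used for the class b: its coordinates are the
    -- digits of b, so its indicator selects exactly that class.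
    α : ℕ → Fin q → Fin (2 ^ ℓ)
    α b i = toZ ℓ (highBits (toℕ i * ℓ) b)

    digits-hit : ∀ b → b < 2 ^ d → ∀ x → (∀ i → α b i ≡ digit k ℓ f (toℕ i) x) ⇔ (low x ≡ b)
    digits-hit b b< x = mk⇔
      (λ eq → trans (digits-determine ℓ q (λ i i<q → sym (begin
          nthDigit ℓ i b                                   ≡⟨ cong (λ i → nthDigit ℓ i b) (FinP.toℕ-fromℕ< i<q) ⟨
          nthDigit ℓ (toℕ (fromℕ< i<q)) b                  ≡⟨ toℕ-toZ ℓ _ ⟨
          toℕ (α b (fromℕ< i<q))                           ≡⟨ cong toℕ (eq (fromℕ< i<q)) ⟩
          toℕ (digit k ℓ f (toℕ (fromℕ< i<q)) x)           ≡⟨ toℕ-digit k ℓ f (toℕ (fromℕ< i<q)) x ⟩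
          nthDigit ℓ (toℕ (fromℕ< i<q)) (toℕ (f x))        ≡⟨ cong (λ i → nthDigit ℓ i (toℕ (f x))) (FinP.toℕ-fromℕ< i<q) ⟩
          nthDigit ℓ i (toℕ (f x))                         ∎)))
        (m<n⇒m%n≡m {{2^≢0 d}} b<))
      (λ eq i → FinP.toℕ-injective (begin
          toℕ (α b i)                                      ≡⟨ toℕ-toZ ℓ _ ⟩
          nthDigit ℓ (toℕ i) b                             ≡⟨ cong (nthDigit ℓ (toℕ i)) eq ⟨
          nthDigit ℓ (toℕ i) (low x)                       ≡⟨ nthDigit-modPow2 ℓ q (toℕ i) (toℕ (f x)) (FinP.toℕ<n i) ⟩
          nthDigit ℓ (toℕ i) (toℕ (f x))                   ≡⟨ toℕ-digit k ℓ f (toℕ i) x ⟨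
          toℕ (digit k ℓ f (toℕ i) x)                      ∎))

    module _ (m : ℕ) where

      ω : S.Carrier
      ω = S.ζ S.↑ (2 ^ (ℓ ∸ m))

      -- Adding 2^{ℓ-m} a to the exponent on the class b multiplies those terms by ω^a and no
      -- others.
      walsh-fF : ∀ u b → b < 2 ^ d → ∀ a →
        walsh j 1 (λ x → toℕ (fF k ℓ (suc q) m f (indF ℓ a (α b)) x)) u ≡ rest u b S.⊕ ω S.↑ a S.⊗ part u b
      walsh-fF u b b< a = begin
        walsh j 1 (λ x → toℕ (fF k ℓ (suc q) m f (indF ℓ a (α b)) x)) u
          ≡⟨ S.∑-cong (allV n) term ⟩
        S.∑ (allV n) (λ x → off x S.⊕ ω S.↑ a S.⊗ on x)
          ≡⟨ S.∑-⊕ (allV n) _ _ ⟩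
        rest u b S.⊕ S.∑ (allV n) (λ x → ω S.↑ a S.⊗ on x)
          ≡⟨ cong (rest u b S.⊕_) (S.∑-⊗ˡ (allV n) _ _) ⟨
        rest u b S.⊕ ω S.↑ a S.⊗ part u b ∎
        where
        open S.Solver using (solve; _:*_; _:=_)
        on off : V n → S.Carrier
        on x = if does (low x ≟ b) then t u x else S.0#
        off x = if does (low x ≟ b) then S.0# else t u x

        F : V n → ℕ
        F x = indF ℓ a (α b) (λ i → digit k ℓ f (toℕ i) x)

        F-value : ∀ x → F x ≡ (if does (low x ≟ b) then a else 0)
        F-value x = cong (if_then a else 0) (does-⇔ (digits-hit b b< x) (FinP.all? _) (low x ≟ b))

        select : ∀ c s → ω S.↑ (if c then a else 0) S.⊗ s ≡ (if c then S.0# else s) S.⊕ ω S.↑ a S.⊗ (if c then s else S.0#)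
        select true s = sym (S.+-identityˡ _)
        select false s = trans (S.*-identityˡ s) (sym (trans (cong (s S.⊕_) (S.zeroʳ _)) (S.+-identityʳ s)))

        term : ∀ x → S.sign (inner u x) S.⊗ S.ζ S.↑ (1 * toℕ (fF k ℓ (suc q) m f (indF ℓ a (α b)) x))
                     ≡ off x S.⊕ ω S.↑ a S.⊗ on x
        term x = begin
          S.sign (inner u x) S.⊗ S.ζ S.↑ (1 * toℕ (fF k ℓ (suc q) m f (indF ℓ a (α b)) x))
            ≡⟨ cong (λ e → S.sign (inner u x) S.⊗ S.ζ S.↑ e) (trans (ℕP.*-identityˡ _) (toℕ-toZ ℓ _)) ⟩
          S.sign (inner u x) S.⊗ S.ζ S.↑ modPow2 ℓ (top x + 2 ^ (ℓ ∸ m) * F x)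
            ≡⟨ cong (S.sign (inner u x) S.⊗_) (ζ↑-mod j (top x + 2 ^ (ℓ ∸ m) * F x)) ⟩
          S.sign (inner u x) S.⊗ S.ζ S.↑ (top x + 2 ^ (ℓ ∸ m) * F x)
            ≡⟨ cong (S.sign (inner u x) S.⊗_) (S.^-homo-* S.ζ (top x) _) ⟩
          S.sign (inner u x) S.⊗ (S.ζ S.↑ top x S.⊗ S.ζ S.↑ (2 ^ (ℓ ∸ m) * F x))
            ≡⟨ cong₂ (λ e z → S.sign (inner u x) S.⊗ (S.ζ S.↑ e S.⊗ z))
                     (sym (ℕP.*-identityˡ (top x))) (sym (S.^-assocʳ S.ζ (2 ^ (ℓ ∸ m)) (F x))) ⟩
          S.sign (inner u x) S.⊗ (S.ζ S.↑ (1 * top x) S.⊗ ω S.↑ F x)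
            ≡⟨ solve 3 (λ a b c → a :* (b :* c) := c :* (a :* b)) refl _ _ _ ⟩
          ω S.↑ F x S.⊗ t u x
            ≡⟨ cong (λ e → ω S.↑ e S.⊗ t u x) (F-value x) ⟩
          ω S.↑ (if does (low x ≟ b) then a else 0) S.⊗ t u x
            ≡⟨ select (does (low x ≟ b)) (t u x) ⟩
          off x S.⊕ ω S.↑ a S.⊗ on x ∎

    module Rigid (m′ : ℕ) (m≤ℓ : suc (suc m′) ≤ ℓ)
      (rigid : ∀ α a → (a ≡ 1 ⊎ a ≡ 2 ^ suc m′) → ∀ u →
         absSq n ℓ 1 (λ x → toℕ (fF k ℓ (suc q) (suc (suc m′)) f (indF ℓ a α) x)) u ≈[ ℓ ] absSq n ℓ 1 top u) where
      private
        m : ℕ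
        m = suc (suc m′)

      ω-minus : ω m S.↑ (2 ^ suc m′) ≡ S.⊖ S.1#
      ω-minus = begin
        (S.ζ S.↑ (2 ^ (ℓ ∸ m))) S.↑ (2 ^ suc m′) ≡⟨ S.^-assocʳ S.ζ (2 ^ (ℓ ∸ m)) (2 ^ suc m′) ⟩
        S.ζ S.↑ (2 ^ (ℓ ∸ m) * 2 ^ suc m′)       ≡⟨ cong (S.ζ S.↑_) (ℕP.^-distribˡ-+-* 2 (ℓ ∸ m) (suc m′)) ⟨
        -- The exponents add up to (ℓ - m) + (m - 1) = ℓ - 1 = j, half the order of ζ.
        S.ζ S.↑ (2 ^ (ℓ ∸ m + suc m′))           ≡⟨ cong (λ e → S.ζ S.↑ (2 ^ e)) (ℕP.m∸n+n≡m (s≤s⁻¹ m≤ℓ)) ⟩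
        S.ζ S.↑ (2 ^ j)                          ≡⟨ ζ↑half j ⟩
        S.⊖ S.1#                                 ∎

      norm-fF : ∀ u b → b < 2 ^ d → ∀ a → (a ≡ 1 ⊎ a ≡ 2 ^ suc m′) →
        (rest u b S.⊕ ω m S.↑ a S.⊗ part u b) S.⊗ S.conj (rest u b S.⊕ ω m S.↑ a S.⊗ part u b)
          ≡ (rest u b S.⊕ part u b) S.⊗ S.conj (rest u b S.⊕ part u b)
      norm-fF u b b< a a∈ = begin
        (rest u b S.⊕ ω m S.↑ a S.⊗ part u b) S.⊗ S.conj (rest u b S.⊕ ω m S.↑ a S.⊗ part u b)
          ≡⟨ cong (λ z → z S.⊗ S.conj z) (walsh-fF m u b b< a) ⟨
        walsh j 1 h u S.⊗ S.conj (walsh j 1 h u)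
          ≡⟨ fromCoeffs-absSq j 1 h u ⟨
        fromCoeffs j (absSq n ℓ 1 h u)
          ≡⟨ fromCoeffs-cong j (rigid (α b) a a∈ u) ⟩
        fromCoeffs j (absSq n ℓ 1 top u)
          ≡⟨ fromCoeffs-absSq j 1 top u ⟩
        walsh j 1 top u S.⊗ S.conj (walsh j 1 top u)
          ≡⟨ cong (λ z → z S.⊗ S.conj z) (walsh-split u b) ⟩
        (rest u b S.⊕ part u b) S.⊗ S.conj (rest u b S.⊕ part u b) ∎
        where
        h : V n → ℕ
        h x = toℕ (fF k ℓ (suc q) m f (indF ℓ a (α b)) x)

      part-projects : ∀ u b → b ∈ classes → part u b S.⊗ S.conj (S.∑ classes (part u)) ≡ part u b S.⊗ S.conj (part u b)
      part-projects u b b∈ = begin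
        A S.⊗ S.conj (S.∑ classes (part u))   ≡⟨ cong (λ z → A S.⊗ S.conj z) (trans (walsh-top u) (walsh-split u b)) ⟩
        A S.⊗ S.conj (rest u b S.⊕ A)             ≡⟨ cong (A S.⊗_) (S.conj-⊕ _ _) ⟩
        A S.⊗ (S.conj (rest u b) S.⊕ S.conj A)    ≡⟨ S.distribˡ _ _ _ ⟩
        A S.⊗ S.conj (rest u b) S.⊕ A S.⊗ S.conj A ≡⟨ cong (S._⊕ A S.⊗ S.conj A) AD̄≡0 ⟩
        S.0# S.⊕ A S.⊗ S.conj A                   ≡⟨ S.+-identityˡ _ ⟩
        A S.⊗ S.conj A                            ∎
        where
        A : S.Carrier
        A = part u b

        SameNorm : S.Carrier → Set
        SameNorm w = (rest u b S.⊕ w S.⊗ A) S.⊗ S.conj (rest u b S.⊕ w S.⊗ A) ≡ (rest u b S.⊕ A) S.⊗ S.conj (rest u b S.⊕ A)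

        AD̄≡0 : A S.⊗ S.conj (rest u b) ≡ S.0#
        -- Here e = 2^{m-2}, and `2 ^ suc m′` unfolds to `2 * 2 ^ m′`. The values a = 1 and a =
        -- 2^{m-1} supply the phases ω and -1.
        AD̄≡0 = S.rigid-component (2 ^ m′) A (rest u b)
          (S.↑-unitary (2 ^ (ℓ ∸ m)) S.ζ-unitary)
          ω-minus
          (subst SameNorm (S.*-identityʳ (ω m)) (norm-fF u b (∈-upTo⁻ b∈) 1 (inj₁ refl)))
          (subst SameNorm ω-minus (norm-fF u b (∈-upTo⁻ b∈) (2 ^ suc m′) (inj₂ refl)))

      norm-walsh-f : ∀ u → let w = walsh (d + j) 1 (toℕ ∘ f) u in
        w T.⊗ T.conj w ≡ ⟦ walsh j 1 top u S.⊗ S.conj (walsh j 1 top u) ⟧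
      norm-walsh-f u = begin
        walsh (d + j) 1 (toℕ ∘ f) u T.⊗ T.conj (walsh (d + j) 1 (toℕ ∘ f) u)
          ≡⟨ cong (λ z → z T.⊗ T.conj z) (walsh-f u) ⟨
        T.∑ classes (λ b → T.ζ T.↑ b T.⊗ ⟦ part u b ⟧) T.⊗ T.conj (T.∑ classes (λ b → T.ζ T.↑ b T.⊗ ⟦ part u b ⟧))
          ≡⟨ norm-twisted-∑ (embed d j) _≟_ (upTo⁺ (2 ^ d)) (part u) (T.ζ T.↑_)
               (λ b → T.↑-unitary b T.ζ-unitary) (part-projects u) ⟩
        ⟦ S.∑ classes (part u) S.⊗ S.conj (S.∑ classes (part u)) ⟧
          ≡⟨ cong (λ z → ⟦ z S.⊗ S.conj z ⟧) (walsh-top u) ⟩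
        ⟦ walsh j 1 top u S.⊗ S.conj (walsh j 1 top u) ⟧ ∎

      absSq-f : ∀ u → fromCoeffs (d + j) (absSq n k 1 (toℕ ∘ f) u) ≡ ⟦ fromCoeffs j (absSq n ℓ 1 top u) ⟧
      absSq-f u = trans (fromCoeffs-absSq (d + j) 1 (toℕ ∘ f) u)
        (trans (norm-walsh-f u) (cong ⟦_⟧ (sym (fromCoeffs-absSq j 1 top u))))

      absSq-equal : ∀ u → absSq n k 1 (toℕ ∘ f) u ≈[ k ] absSq n k (2 ^ (k ∸ ℓ)) top u
      absSq-equal u = fromCoeffs-injective (d + j) (begin
        fromCoeffs (d + j) (absSq n k 1 (toℕ ∘ f) u)
          ≡⟨ trans (absSq-f u) (cong ⟦_⟧ (fromCoeffs-absSq j 1 top u)) ⟩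
        ⟦ walsh j 1 top u S.⊗ S.conj (walsh j 1 top u) ⟧
          ≡⟨ ⟦⟧-norm _ ⟩
        ⟦ walsh j 1 top u ⟧ T.⊗ T.conj ⟦ walsh j 1 top u ⟧
          ≡⟨ cong (λ z → z T.⊗ T.conj z) (walsh-embed top u) ⟨
        walsh (d + j) (2 ^ d) top u T.⊗ T.conj (walsh (d + j) (2 ^ d) top u)
          ≡⟨ fromCoeffs-absSq (d + j) (2 ^ d) top u ⟨
        fromCoeffs (d + j) (absSq n k (2 ^ d) top u)
          -- The exponent k - ℓ reduces to d + j - j, hence equals d.
          ≡⟨ cong (λ e → fromCoeffs (d + j) (absSq n k (2 ^ e) top u)) (ℕP.m+n∸n≡m d j) ⟨
        fromCoeffs (d + j) (absSq n k (2 ^ (k ∸ ℓ)) top u) ∎)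

      AbsIs-⇔ : ∀ u mm v → AbsIs n k f u mm v ⇔ AbsIs n ℓ (digit k ℓ f q) u mm v
      AbsIs-⇔ u mm v = mk⇔
        (λ eq → fromCoeffs-injective j (⟦⟧-injective
          (trans (sym (absSq-f u)) (trans (fromCoeffs-cong (d + j) eq) (fromCoeffs-const d j _)))))
        (λ eq → fromCoeffs-injective (d + j)
          (trans (absSq-f u) (trans (cong ⟦_⟧ (fromCoeffs-cong j eq)) (sym (fromCoeffs-const d j _)))))

      -- The transforms live in different rings and only their norms are related; definiteness of
      -- the norm recovers the supports from these.
      walsh-zero-⇔ : ∀ u → (walsh (d + j) 1 (toℕ ∘ f) u ≡ T.0#) ⇔ (walsh j 1 top u ≡ S.0#)
      walsh-zero-⇔ u = mk⇔
        (λ eq → S.norm-definite (⟦⟧-injective (trans (sym (norm-walsh-f u))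
          (trans (cong (λ z → z T.⊗ T.conj z) eq) (trans (T.zeroˡ _) (sym ⟦⟧-0))))))
        (λ eq → T.norm-definite (trans (norm-walsh-f u)
          (trans (cong (λ z → ⟦ z S.⊗ S.conj z ⟧) eq) (trans (cong ⟦_⟧ (S.zeroˡ _)) ⟦⟧-0))))

      InSupp-⇔ : ∀ u → InSupp n k f u ⇔ InSupp n ℓ (digit k ℓ f q) u
      InSupp-⇔ u = mk⇔
        (λ nz z → nz (unvanish (d + j) _ (Equivalence.from (walsh-zero-⇔ u) (vanish j top z))))
        (λ nz z → nz (unvanish j top (Equivalence.to (walsh-zero-⇔ u) (vanish (d + j) (toℕ ∘ f) z))))
        where
        vanish : ∀ i h → Wt n (suc i) 1 h u ≈[ suc i ] const (+ 0) → walsh i 1 h u ≡ Tower.0# i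
        vanish i h z = trans (sym (fromCoeffs-Wt i 1 h u)) (trans (fromCoeffs-cong i z) (fromCoeffs-const-0 i))

        unvanish : ∀ i h → walsh i 1 h u ≡ Tower.0# i → Wt n (suc i) 1 h u ≈[ suc i ] const (+ 0)
        unvanish i h eq = fromCoeffs-injective i (trans (fromCoeffs-Wt i 1 h u) (trans eq (sym (fromCoeffs-const-0 i))))

      IsLevel-⇔ : ∀ mm v → IsLevel n k f mm v ⇔ IsLevel n ℓ (digit k ℓ f q) mm v
      IsLevel-⇔ mm v = mk⇔
        (λ (o , u , s , e) → o , u , Equivalence.to (InSupp-⇔ u) s , Equivalence.to (AbsIs-⇔ u mm v) e)
        (λ (o , u , s , e) → o , u , Equivalence.from (InSupp-⇔ u) s , Equivalence.from (AbsIs-⇔ u mm v) e)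

      landscape : Landscape n ℓ (digit k ℓ f q) → Landscape n k f
      landscape ((u₀ , s₀) , levels) =
        (u₀ , Equivalence.from (InSupp-⇔ u₀) s₀) ,
        λ u s → let mm , v , o , e = levels u (Equivalence.to (InSupp-⇔ u) s)
                in mm , v , o , Equivalence.from (AbsIs-⇔ u mm v) e

theorem4p7 : (n ℓ r m k : ℕ) → Even n → 2 ≤ n → 2 ≤ ℓ → 2 ≤ r → 2 ≤ m → m ≤ ℓ → k ≡ ℓ * r →
    (f : V n → Fin (2 ^ k)) →
    Landscape n ℓ (digit k ℓ f (r ∸ 1)) →
    (∀ (α : Fin (r ∸ 1) → Fin (2 ^ ℓ)) (a : ℕ) → (a ≡ 1 ⊎ a ≡ 2 ^ (m ∸ 1)) →
    Landscape n ℓ (fF k ℓ r m f (indF ℓ a α)) ×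
    (∀ u → absSq n ℓ 1 (λ x → toℕ (fF k ℓ r m f (indF ℓ a α) x)) u
    ≈[ ℓ ] absSq n ℓ 1 (λ x → toℕ (digit k ℓ f (r ∸ 1) x)) u)) →
    Landscape n k f ×
    (∀ mm v → IsLevel n k f mm v ⇔ IsLevel n ℓ (digit k ℓ f (r ∸ 1)) mm v) ×
    (∀ u → absSq n k 1 (λ x → toℕ (f x)) u
    ≈[ k ] absSq n k (2 ^ (k ∸ ℓ)) (λ x → toℕ (digit k ℓ f (r ∸ 1) x)) u)
theorem4p7 n (suc j) (suc q) (suc (suc m′)) k _ _ _ _ (s≤s (s≤s z≤n)) m≤ℓ k≡ f land rigid
  -- The equation k = ℓ r is first brought to the form `suc (d + j)`, so that matching on it
  -- identifies k with the modulus exponent used in `Main`.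
  with trans k≡ (trans (ℕP.*-comm (suc j) (suc q)) (cong suc (ℕP.+-comm j (q * suc j))))
... | refl = landscape land , IsLevel-⇔ , absSq-equal
  where open Main.Rigid n j q f m′ m≤ℓ (λ α a a∈ → proj₂ (rigid α a a∈))
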